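{- Let $\mathcal K$ be one of $\mathcal{LO}_p^H$, $\mathcal{LO}_{sp}^H$, $\mathcal{LO}_r^H$, $\mathcal{LO}_{sr}^H$, where $H$ is any (possibly empty) set of conditions each expressible by a 1-universal sentence. If $\mathcal K$ is nonempty and $\mathcal K^{fg}$ is the class of all finitely generated members of $\mathcal K$, then $\mathcal K^{fg}$ has a Fraïssé limit that belongs to $\mathcal K$.
   Context: $\mathcal{LO}_p$, $\mathcal{LO}_{sp}$, $\mathcal{LO}_r$, $\mathcal{LO}_{sr}$: linearly ordered sets with one unary operation $f$ which is respectively order preserving ($a\le b\Rightarrow f(a)\le f(b)$), strict order preserving ($a<b\Rightarrow f(a)<f(b)$), order reversing ($a\le b\Rightarrow f(a)\ge f(b)$), strict order reversing ($a<b\Rightarrow f(a)>f(b)$). For a set $H$ of conditions, $\mathcal K^H$ is the subclass of structures satisfying all conditions in $H$. A first-order sentence is 1-universal if it is universal and only one variable occurs in it. A Fraïssé limit of a class $\mathcal F$ of finitely generated structures in a countable language is a countable ultrahomogeneous structure whose age (class of finitely generated structures embeddable in it, up to isomorphism) is exactly $\mathcal F$. -}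

module Defs where

open import Data.Nat using (ℕ; zero; suc)
open import Data.Product using (Σ; _×_; ∃; _,_)
open import Data.Sum using (_⊎_)
open import Data.Empty using (⊥)
open import Data.Unit using (⊤)
open import Data.List using (List)
open import Data.List.Membership.Propositional using (_∈_)
open import Relation.Nullary using (¬_)
open import Relation.Binary.PropositionalEquality using (_≡_)
open import Relation.Binary.Structures using (IsTotalOrder)
open import Function.Bundles using (_⇔_)
open import Function.Definitions using (Injective; Surjective)

record Structure : Set₁ where
  field
    Carrier : Set
    _≤_     : Carrier → Carrier → Set
    isLinearOrder : IsTotalOrder _≡_ _≤_
    f       : Carrier → Carrier

  _<_ : Carrier → Carrier → Set
  a < b = (a ≤ b) × ¬ (a ≡ b)

  fⁿ : ℕ → Carrier → Carrier
  fⁿ zero    a = a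
  fⁿ (suc n) a = f (fⁿ n a)

open Structure public

data Kind : Set where
  p sp r sr : Kind

BaseCond : Kind → Structure → Set
BaseCond p  M = ∀ a b → _≤_ M a b → _≤_ M (f M a) (f M b)
BaseCond sp M = ∀ a b → _<_ M a b → _<_ M (f M a) (f M b)
BaseCond r  M = ∀ a b → _≤_ M a b → _≤_ M (f M b) (f M a)
BaseCond sr M = ∀ a b → _<_ M a b → _<_ M (f M b) (f M a)

-- 1-universal sentences: ∀x φ(x), φ quantifier-free in the single
-- variable x.  Terms in x are exactly fⁿ(x), represented by n.

data QF : Set where
  eqA  : ℕ → ℕ → QF
  leA  : ℕ → ℕ → QF
  falseF trueF : QF
  notF : QF → QF
  andF orF impF : QF → QF → QF

-- A 1-universal sentence ∀x φ(x) is represented by its matrix φ.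
OneUniversal : Set
OneUniversal = QF

Sat : (M : Structure) → QF → Carrier M → Set
Sat M (eqA n m)   a = fⁿ M n a ≡ fⁿ M m a
Sat M (leA n m)   a = _≤_ M (fⁿ M n a) (fⁿ M m a)
Sat M falseF      a = ⊥
Sat M trueF       a = ⊤
Sat M (notF φ)    a = ¬ Sat M φ a
Sat M (andF φ ψ)  a = Sat M φ a × Sat M ψ a
Sat M (orF φ ψ)   a = Sat M φ a ⊎ Sat M ψ a
Sat M (impF φ ψ)  a = Sat M φ a → Sat M ψ a

_⊨_ : Structure → OneUniversal → Set
M ⊨ φ = ∀ a → Sat M φ a

Conditions : Set₁
Conditions = OneUniversal → Set

KH : Kind → Conditions → Structure → Set
KH k H M = BaseCond k M × (∀ φ → H φ → M ⊨ φ)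

FinGen : Structure → Set
FinGen M = Σ (List (Carrier M)) λ gs →
  ∀ a → Σ (Carrier M) λ g → (g ∈ gs) × Σ ℕ λ n → a ≡ fⁿ M n g

KHfg : Kind → Conditions → Structure → Set
KHfg k H A = FinGen A × KH k H A

record Embedding (A B : Structure) : Set where
  field
    map       : Carrier A → Carrier B
    injective : Injective _≡_ _≡_ map
    pres-f    : ∀ a → map (f A a) ≡ f B (map a)
    pres-≤    : ∀ a b → _≤_ A a b ⇔ _≤_ B (map a) (map b)

open Embedding public

Embeds : Structure → Structure → Set
Embeds A B = Embedding A B

record Automorphism (M : Structure) : Set where
  field
    emb        : Embedding M M
    surjective : Surjective _≡_ _≡_ (map emb)

open Automorphism public

Countable : Set → Set
Countable X = Σ (X → ℕ) (Injective _≡_ _≡_)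

-- Every isomorphism between finitely generated substructures extends to
-- an automorphism (substructures given as images of embeddings of a
-- finitely generated structure A; the isomorphism is e₂ ∘ e₁⁻¹).
Ultrahomogeneous : Structure → Set₁
Ultrahomogeneous M = ∀ (A : Structure) → FinGen A →
  (e₁ e₂ : Embedding A M) →
  Σ (Automorphism M) λ σ → ∀ a → map (emb σ) (map e₁ a) ≡ map e₂ a

AgeIs : Structure → (Structure → Set) → Set₁
AgeIs M F = ∀ (A : Structure) → (FinGen A × Embeds A M) ⇔ F A

IsFraisseLimit : (Structure → Set) → Structure → Set₁
IsFraisseLimit F M = Countable (Carrier M) × Ultrahomogeneous M × AgeIs M F

{-# OPTIONS --safe #-}
module Submission where

-- The limit is the union of a chain of countable members of the class, each obtained
-- from the previous one by amalgamation with a one-point extension of a finitely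
-- generated substructure; it is then homogeneous by back and forth.  Three facts make
-- this work.  A 1-universal condition concerns single orbits only, so it passes to any
-- amalgam whose universe is the union of the two factors.  Amalgams of that kind exist:
-- two elements of the two factors are compared by the first of their iterates that
-- are separated by the common part, and those that are never separated are ordered by
-- a convention.  If f reverses the order, this convention must change at the fixed
-- point of f, so a (possibly virtual) fixed point is added to every structure; if f
-- preserves the order, a virtual largest element plays the same role.  Finally there
-- are only countably many problems to solve: the type of a tuple is determined by
-- the types of its pairs, and a pair of orbits of the order-preserving map f or f ∘ f
-- either meets, or interlaces with a constant shift, hence has finitely much information.

open import Defs
open import Data.Product using (Σ; _×_)
open import Axiom.ExcludedMiddle using (ExcludedMiddle)
open import Level using (0ℓ)

open import Data.Bool using (Bool; true; false; not; T)
open import Data.Bool.Properties using (T-irrelevant)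
open import Data.Empty using (⊥; ⊥-elim)
open import Data.List as List using (List; []; _∷_; filter; cartesianProduct; upTo; length)
open import Data.List.Membership.Propositional using (_∈_)
open import Data.List.Membership.Propositional.Properties
  using (∈-map⁺; ∈-map⁻; ∈-filter⁺; ∈-filter⁻; ∈-cartesianProduct⁺; ∈-upTo⁺)
open import Data.List.Relation.Unary.Any using (here; there)
open import Data.Maybe as Maybe using (Maybe; just; nothing)
open import Data.Nat as ℕ using (ℕ; zero; suc; _+_; _∸_)
import Data.Nat.Properties as ℕ
open import Data.Nat.GeneralisedArithmetic using (fold; fold-+)
open import Data.Product using (_,_; proj₁; proj₂; swap)
open import Data.Sum as Sum using (_⊎_; inj₁; inj₂; [_,_]′)
open import Data.Unit using (⊤; tt)
open import Function.Base using (flip)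
open import Function.Bundles using (_⇔_; mk⇔; Equivalence)
open import Function.Construct.Composition using (_⇔-∘_)
open import Function.Construct.Symmetry using (⇔-sym)
open import Relation.Binary.PropositionalEquality
  using (_≡_; refl; sym; trans; cong; cong₂; subst; subst₂; isEquivalence; module ≡-Reasoning)
open import Relation.Binary.Structures using (IsTotalOrder)
open import Relation.Nullary using (¬_; Dec; yes; no)
open import Relation.Nullary.Decidable using (True; isYes; toWitness; fromWitness; decidable-stable)

open Equivalence using (to; from)

-- Pointed prestructures and their amalgamation

iter : {X : Set} → (X → X) → ℕ → X → X
iter g n x = fold x g n

-- A direction is a Boolean; false reverses a relation.
Dir : {X : Set} → Bool → (X → X → Set) → X → X → Set
Dir true  R x y = R x y
Dir false R x y = R y x

-- `turn s d` is the direction that an inequality of direction `d` takes after one application of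
-- the operation.
turn : Bool → Bool → Bool
turn true  d = d
turn false d = not d

-- s says whether the operation preserves or reverses the preorder, t whether it does
-- so strictly.
record IsPre (s t : Bool) {X : Set} (R : X → X → Set) (g : X → X) (o : X) : Set where
  field
    transitive : ∀ {x y z} → R x y → R y z → R x z
    total  : ∀ x y → R x y ⊎ R y x
    mono   : ∀ {x y} → R x y → Dir s R (g x) (g y)
    cancel : T t → ∀ {x y} → Dir s R (g x) (g y) → R x y
    fix≤   : R (g o) o
    fix≥   : R o (g o)
    top    : T s → ∀ x → R x o

  reflexive : ∀ x → R x x
  reflexive x = [ (λ q → q) , (λ q → q) ]′ (total x x)

  dir-trans : ∀ d {x y z} → Dir d R x y → Dir d R y z → Dir d R x z
  dir-trans true  q q′ = transitive q q′
  dir-trans false q q′ = transitive q′ q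

module _ {s t : Bool} {X : Set} {R : X → X → Set} {g : X → X} {o : X} (pre : IsPre s t R g o) where
  private module M = IsPre pre

  dir-mono : ∀ d {x y} → Dir d R x y → Dir (turn s d) R (g x) (g y)
  dir-mono = go s M.mono
    where
    go : ∀ s → (∀ {x y} → R x y → Dir s R (g x) (g y)) →
         ∀ d {x y} → Dir d R x y → Dir (turn s d) R (g x) (g y)
    go true  m true  q = m q
    go true  m false q = m q
    go false m true  q = m q
    go false m false q = m q

  dir-cancel : T t → ∀ d {x y} → Dir (turn s d) R (g x) (g y) → Dir d R x y
  dir-cancel w = go s (M.cancel w)
    where
    go : ∀ s → (∀ {x y} → Dir s R (g x) (g y) → R x y) →
         ∀ d {x y} → Dir (turn s d) R (g x) (g y) → Dir d R x y
    go true  m true  q = m q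
    go true  m false q = m q
    go false m true  q = m q
    go false m false q = m q

  iter-fix : ∀ n → R (iter g n o) o × R o (iter g n o)
  iter-fix zero    = M.reflexive o , M.reflexive o
  iter-fix (suc n) = go s M.mono (iter-fix n)
    where
    go : ∀ s → (∀ {x y} → R x y → Dir s R (g x) (g y)) → R (iter g n o) o × R o (iter g n o) →
         R (g (iter g n o)) o × R o (g (iter g n o))
    go true  m (q , q′) = M.transitive (m q) M.fix≤ , M.transitive M.fix≥ (m q′)
    go false m (q , q′) = M.transitive (m q′) M.fix≤ , M.transitive M.fix≥ (m q)

module Amalgam (em : ExcludedMiddle 0ℓ) {s t : Bool}
  {X : Set} {RX : X → X → Set} {gX : X → X} {oX : X} (preX : IsPre s t RX gX oX)
  {Y : Set} {RY : Y → Y → Set} {gY : Y → Y} {oY : Y} (preY : IsPre s t RY gY oY)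
  (P : X → Y → Set) (P-o : P oX oY) (P-g : ∀ {x y} → P x y → P (gX x) (gY y))
  (P-iso : ∀ {x y x′ y′} → P x y → P x′ y′ → RX x x′ ⇔ RY y y′)
  where

  private
    module M = IsPre preX
    module N = IsPre preY

  W : Set
  W = X ⊎ Y

  gW : W → W
  gW = Sum.map gX gY

  -- The common part of the two factors, encoded as the graph of the partial isomorphism.
  Z : Set
  Z = Σ X λ x → Σ Y λ y → P x y

  gZ : Z → Z
  gZ (x , y , q) = gX x , gY y , P-g q

  oZ : Z
  oZ = oX , oY , P-o

  Cut : Bool → W → Z → Set
  Cut d (inj₁ x) (x′ , _ , _) = Dir d RX x x′
  Cut d (inj₂ y) (_ , y′ , _) = Dir d RY y y′

  P-iso-dir : ∀ d {x y x′ y′} → P x y → P x′ y′ → Dir d RX x x′ ⇔ Dir d RY y y′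
  P-iso-dir true  q q′ = P-iso q q′
  P-iso-dir false q q′ = P-iso q′ q

  cut-g : ∀ d w z → Cut d w z → Cut (turn s d) (gW w) (gZ z)
  cut-g d (inj₁ x) z q = dir-mono preX d q
  cut-g d (inj₂ y) z q = dir-mono preY d q

  cut-total : ∀ d w z → Cut d w z ⊎ Cut (not d) w z
  cut-total true  (inj₁ x) z = M.total _ _
  cut-total false (inj₁ x) z = M.total _ _
  cut-total true  (inj₂ y) z = N.total _ _
  cut-total false (inj₂ y) z = N.total _ _

  -- u ≤ z ≤ v ≤ z′ implies u ≤ z′, in direction d.
  bridge : ∀ d u v z z′ → Cut d u z → Cut (not d) v z → Cut d v z′ → Cut d u z′
  bridge d u v z z′ q₁ q₂ q₃ = step u (mid d v q₂ q₃) q₁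
    where
    mid : ∀ d v → Cut (not d) v z → Cut d v z′ → Dir d RX (proj₁ z) (proj₁ z′)
    mid true  (inj₁ x) q q′ = M.transitive q q′
    mid false (inj₁ x) q q′ = M.transitive q′ q
    mid true  (inj₂ y) q q′ = from (P-iso (proj₂ (proj₂ z)) (proj₂ (proj₂ z′))) (N.transitive q q′)
    mid false (inj₂ y) q q′ = from (P-iso (proj₂ (proj₂ z′)) (proj₂ (proj₂ z))) (N.transitive q′ q)
    step : ∀ u → Dir d RX (proj₁ z) (proj₁ z′) → Cut d u z → Cut d u z′
    step (inj₁ x) q q₁ = M.dir-trans d q₁ q
    step (inj₂ y) q q₁ = N.dir-trans d q₁ (to (P-iso-dir d (proj₂ (proj₂ z)) (proj₂ (proj₂ z′))) q)

  -- `z` lies weakly between `u` and `v`; the negated conjunct says that they are not both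
  -- equivalent to `z`.
  Sep : Bool → W → W → Z → Set
  Sep d u v z = Cut d u z × Cut (not d) v z × ¬ (Cut (not d) u z × Cut d v z)

  -- Some iterates of u and v are separated by an element of P, in a way that
  -- forces u to lie before v in direction d.
  data _⊏[_]_ (u : W) (d : Bool) (v : W) : Set where
    here  : ∀ z → Sep d u v z → u ⊏[ d ] v
    there : gW u ⊏[ turn s d ] gW v → u ⊏[ d ] v

  not-not : ∀ d → not (not d) ≡ d
  not-not true  = refl
  not-not false = refl

  turn-not : ∀ s d → turn s (not d) ≡ not (turn s d)
  turn-not true  d = refl
  turn-not false d = refl

  turn-turn : ∀ s d → turn s (turn s d) ≡ d
  turn-turn true  d = refl
  turn-turn false d = not-not d

  ⊏-swap : ∀ d {u v} → u ⊏[ not d ] v → v ⊏[ d ] u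
  ⊏-swap d = go d refl
    where
    go : ∀ d {e u v} → e ≡ not d → u ⊏[ e ] v → v ⊏[ d ] u
    go d {u = u} {v} refl (here z (q₁ , q₂ , q₃)) =
      here z (subst (λ e → Cut e v z) (not-not d) q₂ , q₁ ,
              λ (c , c′) → q₃ (subst (λ e → Cut e u z) (sym (not-not d)) c′ , c))
    go d refl (there q) = there (go (turn s d) (turn-not s d) q)

  -- By `bridge` through `z`, an opposite separation at `z′` would have equivalences on both sides.
  -- Opposite separations of later iterates are refuted by the images of `z`, which stay between the
  -- images of `u` and `v`.
  between-asym : ∀ d {u v} z → Cut d u z → Cut (not d) v z → ¬ v ⊏[ d ] u
  between-asym d {u} {v} z q₁ q₂ (here z′ (c₁ , c₂ , c₃)) =
    c₃ (bridge (not d) v u z z′ q₂ (subst (λ e → Cut e u z) (sym (not-not d)) q₁) c₂ ,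
        bridge d u v z z′ q₁ q₂ c₁)
  between-asym d {u} {v} z q₁ q₂ (there q) =
    between-asym (turn s d) (gZ z) (cut-g d u z q₁)
      (subst (λ e → Cut e (gW v) (gZ z)) (turn-not s d) (cut-g (not d) v z q₂)) q

  ⊏-asym : ∀ d {u v} → u ⊏[ d ] v → ¬ v ⊏[ d ] u
  ⊏-asym d (here z (q₁ , q₂ , _)) q = between-asym d z q₁ q₂ q
  ⊏-asym d {u} {v} (there q) (here z (q₁ , q₂ , _)) = between-asym d {v} {u} z q₁ q₂ (there q)
  ⊏-asym d (there q) (there q′) = ⊏-asym (turn s d) q q′

  -- Compare `v` with the element `z` that separates `u` from `w`. If `v` is equivalent to `z`, then
  -- whichever of the two original inequalities is strict gives the separation. Cotransitivity makes
  -- `Tie` transitive and drives the transitivity of `_≤W_`.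
  ⊏-cotrans : ∀ d {u w} → u ⊏[ d ] w → ∀ v → u ⊏[ d ] v ⊎ v ⊏[ d ] w
  ⊏-cotrans d {u} {w} (here z (q₁ , q₂ , q₃)) v
    with em {Cut d v z} | em {Cut (not d) v z} | em {Cut (not d) u z}
  ... | no ¬c | no ¬c′ | _ = ⊥-elim ([ ¬c , ¬c′ ]′ (cut-total d v z))
  ... | no ¬c | yes c′ | _ = inj₁ (here z (q₁ , c′ , λ (_ , e) → ¬c e))
  ... | yes c | no ¬c′ | _ = inj₂ (here z (c , q₂ , λ (e , _) → ¬c′ e))
  ... | yes c | yes c′ | no ¬e = inj₁ (here z (q₁ , c′ , λ (e , _) → ¬e e))
  ... | yes c | yes c′ | yes e = inj₂ (here z (c , q₂ , λ (_ , e′) → q₃ (e , e′)))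
  ⊏-cotrans d (there q) v = Sum.map there there (⊏-cotrans (turn s d) q (gW v))

  Tie : W → W → Set
  Tie u v = ∀ d → ¬ u ⊏[ d ] v

  tie-intro : ∀ {u v} → ¬ u ⊏[ true ] v → ¬ v ⊏[ true ] u → Tie u v
  tie-intro q q′ true  = q
  tie-intro q q′ false = λ c → q′ (⊏-swap true c)

  tie-sym : ∀ {u v} → Tie u v → Tie v u
  tie-sym q true  c = q false (⊏-swap false c)
  tie-sym q false c = q true (⊏-swap true c)

  tie-trans : ∀ {u v w} → Tie u v → Tie v w → Tie u w
  tie-trans {v = v} q q′ d c = [ q d , q′ d ]′ (⊏-cotrans d c v)

  tie-g : ∀ {u v} → Tie u v → Tie (gW u) (gW v)
  tie-g {u} {v} q d c =
    q (turn s d) (there (subst (λ e → gW u ⊏[ e ] gW v) (sym (turn-turn s d)) c))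

  tie-cut : ∀ {u v} d z → Tie u v → Cut d u z → Cut d v z
  tie-cut {u} {v} d z q c with em {Cut d v z}
  ... | yes c′ = c′
  ... | no ¬c′ = ⊥-elim (q d (here z (c ,
          [ (λ e → ⊥-elim (¬c′ e)) , (λ e → e) ]′ (cut-total d v z) , λ (_ , e) → ¬c′ e)))

  -- Elements with an iterate in P, where proper iterates count only if the
  -- operation is strict: these are the elements that are forced to be identified
  -- with the elements they are tied to.
  data Col (u : W) : Set where
    here  : ∀ z → Cut true u z → Cut false u z → Col u
    there : T t → Col (gW u) → Col u

  tie-col : ∀ {u v} → Tie u v → Col u → Col v
  tie-col q (here z c c′) = here z (tie-cut true z q c) (tie-cut false z q c′)
  tie-col q (there w c)   = there w (tie-col (tie-g q) c)

  col-g : ∀ {u} → Col u → Col (gW u)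
  col-g {u} (here z c c′) = go s (cut-g true u z c) (cut-g false u z c′)
    where
    go : ∀ s → Cut (turn s true) (gW u) (gZ z) → Cut (turn s false) (gW u) (gZ z) → Col (gW u)
    go true  e e′ = here (gZ z) e e′
    go false e e′ = here (gZ z) e′ e
  col-g (there w c) = c

  -- The order inside a tie.  Tied elements lie on the same side of o; those of X
  -- are placed before those of Y below o, and after them above o, because an
  -- order-reversing operation exchanges the two sides.
  Tied : W → W → Set
  Tied (inj₁ x) (inj₁ x′) = RX x x′
  Tied (inj₁ x) (inj₂ y)  = RX x oX
  Tied (inj₂ y) (inj₁ x)  = RX oX x
  Tied (inj₂ y) (inj₂ y′) = RY y y′

  -- The disjoint union is not quotiented: tied elements of `Col` are identified by lying below each
  -- other, because `tie-col` makes the condition symmetric.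
  _≤W_ : W → W → Set
  u ≤W v = u ⊏[ true ] v ⊎ (Tie u v × (Col u ⊎ Tied u v))

  -- The critical case is an element of `X` between two elements of `Y`. The convention then makes
  -- it equivalent to the point, so it lies in `Col`, and so does everything tied to it.
  tied-trans : ∀ {u v w} → Tie u v → Tie v w → Tied u v → Tied v w → Col u ⊎ Tied u w
  tied-trans {inj₁ _} {inj₁ _} {inj₁ _} _ _ q q′ = inj₂ (M.transitive q q′)
  tied-trans {inj₁ _} {inj₁ _} {inj₂ _} _ _ q q′ = inj₂ (M.transitive q q′)
  tied-trans {inj₁ _} {inj₂ _} {inj₁ _} _ _ q q′ = inj₂ (M.transitive q q′)
  tied-trans {inj₁ _} {inj₂ _} {inj₂ _} _ _ q q′ = inj₂ q
  tied-trans {inj₂ _} {inj₁ _} {inj₁ _} _ _ q q′ = inj₂ (M.transitive q q′)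
  tied-trans {inj₂ _} {inj₁ _} {inj₂ _} e _ q q′ = inj₁ (tie-col (tie-sym e) (here oZ q′ q))
  tied-trans {inj₂ _} {inj₂ _} {inj₁ _} _ _ q q′ = inj₂ q′
  tied-trans {inj₂ _} {inj₂ _} {inj₂ _} _ _ q q′ = inj₂ (N.transitive q q′)

  ≤W-trans : ∀ {u v w} → u ≤W v → v ≤W w → u ≤W w
  ≤W-trans {w = w} (inj₁ q) (inj₁ q′) =
    inj₁ ([ (λ c → c) , (λ c → ⊥-elim (⊏-asym true q′ c)) ]′ (⊏-cotrans true q w))
  ≤W-trans {w = w} (inj₁ q) (inj₂ (e , _)) =
    inj₁ ([ (λ c → c) , (λ c → ⊥-elim (tie-sym e true c)) ]′ (⊏-cotrans true q w))
  ≤W-trans {u} (inj₂ (e , _)) (inj₁ q) =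
    inj₁ ([ (λ c → ⊥-elim (tie-sym e true c)) , (λ c → c) ]′ (⊏-cotrans true q u))
  ≤W-trans (inj₂ (e , inj₁ c)) (inj₂ (e′ , _)) = inj₂ (tie-trans e e′ , inj₁ c)
  ≤W-trans (inj₂ (e , inj₂ _)) (inj₂ (e′ , inj₁ c)) =
    inj₂ (tie-trans e e′ , inj₁ (tie-col (tie-sym e) c))
  ≤W-trans {u} {v} {w} (inj₂ (e , inj₂ q)) (inj₂ (e′ , inj₂ q′)) =
    inj₂ (tie-trans e e′ , tied-trans {u} {v} {w} e e′ q q′)

  tied-total : ∀ u v → Tied u v ⊎ Tied v u
  tied-total (inj₁ x) (inj₁ x′) = M.total x x′
  tied-total (inj₁ x) (inj₂ y)  = M.total x oX
  tied-total (inj₂ y) (inj₁ x)  = M.total oX x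
  tied-total (inj₂ y) (inj₂ y′) = N.total y y′

  ≤W-total : ∀ u v → u ≤W v ⊎ v ≤W u
  ≤W-total u v with em {u ⊏[ true ] v} | em {v ⊏[ true ] u}
  ... | yes q | _     = inj₁ (inj₁ q)
  ... | no _  | yes q = inj₂ (inj₁ q)
  ... | no ¬q | no ¬q′ =
    Sum.map (λ q → inj₂ (tie-intro ¬q ¬q′ , inj₂ q)) (λ q → inj₂ (tie-intro ¬q′ ¬q , inj₂ q))
            (tied-total u v)

  dir-intro : ∀ d {u v} → u ⊏[ d ] v ⊎ (Tie u v × (Col u ⊎ Dir d Tied u v)) → Dir d _≤W_ u v
  dir-intro true  q = q
  dir-intro false (inj₁ q) = inj₁ (⊏-swap true q)
  dir-intro false (inj₂ (e , q)) = inj₂ (tie-sym e , Sum.map₁ (tie-col e) q)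

  dir-elim : ∀ d {u v} → Dir d _≤W_ u v → u ⊏[ d ] v ⊎ (Tie u v × (Col u ⊎ Dir d Tied u v))
  dir-elim true  q = q
  dir-elim false (inj₁ q) = inj₁ (⊏-swap false q)
  dir-elim false (inj₂ (e , q)) = inj₂ (tie-sym e , Sum.map₁ (tie-col e) q)

  -- If one of the inequalities is strict, `z` itself separates `u` from `v`. Otherwise both are
  -- equivalent to `z`: `between-asym` in both directions makes them tied, and `z` puts `u` in
  -- `Col`.
  between : ∀ d {u v} z → Cut d u z → Cut (not d) v z → Dir d _≤W_ u v
  between d {u} {v} z q q′ with em {Cut (not d) u z} | em {Cut d v z}
  ... | no ¬c | _     = dir-intro d (inj₁ (here z (q , q′ , λ (c , _) → ¬c c)))
  ... | yes _ | no ¬c = dir-intro d (inj₁ (here z (q , q′ , λ (_ , c) → ¬c c)))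
  ... | yes c | yes c′ = dir-intro d (inj₂ (equal , inj₁ (col d q c)))
    where
    col : ∀ d → Cut d u z → Cut (not d) u z → Col u
    col true  e e′ = here z e e′
    col false e e′ = here z e′ e
    lower : ¬ v ⊏[ d ] u
    lower = between-asym d z q q′
    upper : ¬ v ⊏[ not d ] u
    upper = between-asym (not d) z c (subst (λ e → Cut e v z) (sym (not-not d)) c′)
    both : ∀ d → ¬ v ⊏[ d ] u → ¬ v ⊏[ not d ] u → Tie v u
    both true  a b true  = a
    both true  a b false = b
    both false a b true  = b
    both false a b false = a
    equal : Tie u v
    equal = tie-sym (both d lower upper)

  tied-g : ∀ {u v} → Tied u v → Dir s Tied (gW u) (gW v)
  tied-g {u} {v} = go s M.mono N.mono u v
    where
    go : ∀ s → (∀ {x y} → RX x y → Dir s RX (gX x) (gX y)) → (∀ {x y} → RY x y → Dir s RY (gY x) (gY y)) →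
         ∀ u v → Tied u v → Dir s Tied (gW u) (gW v)
    go true  m n (inj₁ _) (inj₁ _) q = m q
    go true  m n (inj₁ _) (inj₂ _) q = M.transitive (m q) M.fix≤
    go true  m n (inj₂ _) (inj₁ _) q = M.transitive M.fix≥ (m q)
    go true  m n (inj₂ _) (inj₂ _) q = n q
    go false m n (inj₁ _) (inj₁ _) q = m q
    go false m n (inj₁ _) (inj₂ _) q = M.transitive M.fix≥ (m q)
    go false m n (inj₂ _) (inj₁ _) q = M.transitive (m q) M.fix≤
    go false m n (inj₂ _) (inj₂ _) q = n q

  tied-cancel : T t → ∀ {u v} → Dir s Tied (gW u) (gW v) → Tied u v
  tied-cancel w {u} {v} = go s (M.cancel w) (N.cancel w) u v
    where
    go : ∀ s → (∀ {x y} → Dir s RX (gX x) (gX y) → RX x y) → (∀ {x y} → Dir s RY (gY x) (gY y) → RY x y) →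
         ∀ u v → Dir s Tied (gW u) (gW v) → Tied u v
    go true  m n (inj₁ _) (inj₁ _) q = m q
    go true  m n (inj₁ _) (inj₂ _) q = m (M.transitive q M.fix≥)
    go true  m n (inj₂ _) (inj₁ _) q = m (M.transitive M.fix≤ q)
    go true  m n (inj₂ _) (inj₂ _) q = n q
    go false m n (inj₁ _) (inj₁ _) q = m q
    go false m n (inj₁ _) (inj₂ _) q = m (M.transitive M.fix≤ q)
    go false m n (inj₂ _) (inj₁ _) q = m (M.transitive q M.fix≥)
    go false m n (inj₂ _) (inj₂ _) q = n q

  -- A non-strict operation may turn a separation into an equivalence, so a separation by `z` is
  -- passed on through `between` at `gZ z`.
  ≤W-mono : ∀ {u v} → u ≤W v → Dir s _≤W_ (gW u) (gW v)
  ≤W-mono {u} {v} (inj₁ (here z (q , q′ , _))) = go s (cut-g true u z q) (cut-g false v z q′)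
    where
    go : ∀ s → Cut (turn s true) (gW u) (gZ z) → Cut (turn s false) (gW v) (gZ z) →
         Dir s _≤W_ (gW u) (gW v)
    go true  c c′ = between true {gW u} {gW v} (gZ z) c c′
    go false c c′ = between false {gW u} {gW v} (gZ z) c c′
  ≤W-mono {u} {v} (inj₁ (there q)) = go s q
    where
    go : ∀ s → gW u ⊏[ turn s true ] gW v → Dir s _≤W_ (gW u) (gW v)
    go true  c = dir-intro true (inj₁ c)
    go false c = dir-intro false {gW u} {gW v} (inj₁ c)
  ≤W-mono {u} {v} (inj₂ (e , q)) =
    dir-intro s (inj₂ (tie-g e , Sum.map col-g (tied-g {u} {v}) q))

  turn-true : ∀ s → turn s true ≡ s
  turn-true true  = refl
  turn-true false = refl

  cut-cancel : T t → ∀ d w z → Cut (turn s d) (gW w) (gZ z) → Cut d w z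
  cut-cancel w d (inj₁ x) z q = dir-cancel preX w d q
  cut-cancel w d (inj₂ y) z q = dir-cancel preY w d q

  -- A strict operation keeps separations strict, which excludes that `v` is separated below `u`. In
  -- a tie, the constructor `there` of `Col` pulls an identification of the images back to `u` and
  -- `v`.
  ≤W-cancel : T t → ∀ {u v} → Dir s _≤W_ (gW u) (gW v) → u ≤W v
  ≤W-cancel w {u} {v} q with em {u ⊏[ true ] v} | em {v ⊏[ true ] u}
  ... | yes c | _ = inj₁ c
  ... | no ¬c | no ¬c′ = inj₂ (tie-intro ¬c ¬c′ , tied (dir-elim s q))
    where
    tied : gW u ⊏[ s ] gW v ⊎ (Tie (gW u) (gW v) × (Col (gW u) ⊎ Dir s Tied (gW u) (gW v))) →
           Col u ⊎ Tied u v
    tied (inj₁ c) = ⊥-elim (¬c (there (subst (λ e → gW u ⊏[ e ] gW v) (sym (turn-true s)) c)))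
    tied (inj₂ (_ , c)) = Sum.map (there w) (tied-cancel w {u} {v}) c
  ... | no ¬c | yes c = ⊥-elim (absurd (dir-elim s q) (push c))
    where
    push : v ⊏[ true ] u → gW v ⊏[ turn s true ] gW u
    push (there c) = c
    push (here z (c₁ , c₂ , c₃)) = here (gZ z)
      ( cut-g true v z c₁
      , subst (λ e → Cut e (gW u) (gZ z)) (turn-not s true) (cut-g false u z c₂)
      , λ (e₁ , e₂) → c₃ ( cut-cancel w false v z (subst (λ e → Cut e (gW v) (gZ z)) (sym (turn-not s true)) e₁)
                         , cut-cancel w true u z e₂))
    absurd : gW u ⊏[ s ] gW v ⊎ (Tie (gW u) (gW v) × (Col (gW u) ⊎ Dir s Tied (gW u) (gW v))) →
             ¬ (gW v ⊏[ turn s true ] gW u)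
    absurd (inj₁ e) c′ = ⊏-asym s e (subst (λ d → gW v ⊏[ d ] gW u) (turn-true s) c′)
    absurd (inj₂ (e , _)) c′ = tie-sym e (turn s true) c′

  -- The factors embed into the amalgam

  Own : Bool → W → W → Set
  Own d (inj₁ x) (inj₁ x′) = Dir d RX x x′
  Own d (inj₂ y) (inj₂ y′) = Dir d RY y y′
  Own d _ _ = ⊥

  own-cut : ∀ d v u z → Own d v u → Cut d u z → Cut d v z
  own-cut d (inj₁ _) (inj₁ _) z q c = M.dir-trans d q c
  own-cut d (inj₂ _) (inj₂ _) z q c = N.dir-trans d q c

  own-swap : ∀ d v u → Own d v u → Own (not d) u v
  own-swap true  (inj₁ _) (inj₁ _) q = q
  own-swap false (inj₁ _) (inj₁ _) q = q
  own-swap true  (inj₂ _) (inj₂ _) q = q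
  own-swap false (inj₂ _) (inj₂ _) q = q

  own-g : ∀ d v u → Own d v u → Own (turn s d) (gW v) (gW u)
  own-g d (inj₁ _) (inj₁ _) q = dir-mono preX d q
  own-g d (inj₂ _) (inj₂ _) q = dir-mono preY d q

  -- Cuts are closed along the order of a factor, so a separation against that order would consist
  -- of equivalences; the operation carries the argument to all iterates.
  own-asym : ∀ d {u v} → Own d v u → ¬ u ⊏[ d ] v
  own-asym d {u} {v} q (here z (c₁ , c₂ , c₃)) =
    c₃ (own-cut (not d) u v z (own-swap d v u q) c₂ , own-cut d v u z q c₁)
  own-asym d {u} {v} q (there c) = own-asym (turn s d) (own-g d v u q) c

  own-tied : ∀ {u v} → Own true u v → Tied u v
  own-tied {inj₁ _} {inj₁ _} q = q
  own-tied {inj₂ _} {inj₂ _} q = q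

  own⇒≤W : ∀ {u v} → Own true u v → u ≤W v
  own⇒≤W {u} {v} q with em {u ⊏[ true ] v}
  ... | yes c = inj₁ c
  ... | no ¬c = inj₂ (tie-intro ¬c (own-asym true {v} {u} q) , inj₂ (own-tied {u} {v} q))

  -- No two inequivalent elements of one factor are collapsed: tied elements are equivalent to the
  -- same `z`, and an identification of proper iterates is pulled back by strictness.
  col⇒RX : ∀ d {x x′} → Tie (inj₁ x) (inj₁ x′) → Col (inj₁ x) → Dir d RX x x′
  col⇒RX true  e (here z c c′) = M.transitive c (tie-cut false z e c′)
  col⇒RX false e (here z c c′) = M.transitive (tie-cut true z e c) c′
  col⇒RX d e (there w c) = dir-cancel preX w d (col⇒RX (turn s d) (tie-g e) c)

  col⇒RY : ∀ d {y y′} → Tie (inj₂ y) (inj₂ y′) → Col (inj₂ y) → Dir d RY y y′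
  col⇒RY true  e (here z c c′) = N.transitive c (tie-cut false z e c′)
  col⇒RY false e (here z c c′) = N.transitive (tie-cut true z e c) c′
  col⇒RY d e (there w c) = dir-cancel preY w d (col⇒RY (turn s d) (tie-g e) c)

  left : ∀ x x′ → RX x x′ ⇔ (inj₁ x ≤W inj₁ x′)
  left x x′ = mk⇔ own⇒≤W back
    where
    back : inj₁ x ≤W inj₁ x′ → RX x x′
    back (inj₁ c) = [ (λ q → q) , (λ q → ⊥-elim (own-asym true q c)) ]′ (M.total x x′)
    back (inj₂ (e , inj₁ c)) = col⇒RX true e c
    back (inj₂ (e , inj₂ q)) = q

  right : ∀ y y′ → RY y y′ ⇔ (inj₂ y ≤W inj₂ y′)
  right y y′ = mk⇔ own⇒≤W back
    where
    back : inj₂ y ≤W inj₂ y′ → RY y y′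
    back (inj₁ c) = [ (λ q → q) , (λ q → ⊥-elim (own-asym true q c)) ]′ (N.total y y′)
    back (inj₂ (e , inj₁ c)) = col⇒RY true e c
    back (inj₂ (e , inj₂ q)) = q

  glue≤ : ∀ {x y} → P x y → inj₁ x ≤W inj₂ y
  glue≤ {x} {y} q = between true (x , y , q) (M.reflexive x) (N.reflexive y)

  glue≥ : ∀ {x y} → P x y → inj₂ y ≤W inj₁ x
  glue≥ {x} {y} q = between true (x , y , q) (N.reflexive y) (M.reflexive x)

  isPre : IsPre s t _≤W_ gW (inj₁ oX)
  isPre = record
    { transitive = ≤W-trans
    ; total  = ≤W-total
    ; mono   = ≤W-mono
    ; cancel = λ w {u} {v} → ≤W-cancel w {u} {v}
    ; fix≤   = to (left _ _) M.fix≤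
    ; fix≥   = to (left _ _) M.fix≥
    ; top    = λ w → λ { (inj₁ x) → to (left x oX) (M.top w x)
                       -- The two points are matched, so the point of `Y` mediates between `y` and
                       -- the point of `X`.
                       ; (inj₂ y) → between true oZ (N.top w y) (M.reflexive oX) }
    }

-- Countability of the types of pairs

-- Cantor's enumeration of ℕ × ℕ along the antidiagonals.
advance : ℕ × ℕ → ℕ × ℕ
advance (zero  , b) = suc b , zero
advance (suc a , b) = a , suc b

triangle : ℕ → ℕ
triangle zero    = zero
triangle (suc n) = suc n + triangle n

abstract
  unpair : ℕ → ℕ × ℕ
  unpair = fold (zero , zero) advance

  pair : ℕ → ℕ → ℕ
  pair a b = b + triangle (a + b)

  unpair-pair : ∀ a b → unpair (pair a b) ≡ (a , b)
  unpair-pair a b = begin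
    fold (0 , 0) advance (b + triangle (a + b))          ≡⟨ fold-+ _ advance b ⟩
    fold (fold (0 , 0) advance (triangle (a + b))) advance b
                                                         ≡⟨ cong (λ x → fold x advance b) (start (a + b)) ⟩
    fold (a + b , 0) advance b                           ≡⟨ along b a ⟩
    (a , b)                                              ∎
    where
    open ≡-Reasoning
    along : ∀ b a → fold (a + b , 0) advance b ≡ (a , b)
    along zero    a = cong (_, 0) (ℕ.+-identityʳ a)
    along (suc b) a = cong advance (trans (cong (λ c → fold (c , 0) advance b) (ℕ.+-suc a b)) (along b (suc a)))
    start : ∀ n → fold (0 , 0) advance (triangle n) ≡ (n , 0)
    start zero    = refl
    start (suc n) = cong advance (begin
      fold (0 , 0) advance (n + triangle n)              ≡⟨ fold-+ _ advance n ⟩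
      fold (fold (0 , 0) advance (triangle n)) advance n ≡⟨ cong (λ x → fold x advance n) (start n) ⟩
      fold (n , 0) advance n                             ≡⟨ along n 0 ⟩
      (0 , n)                                            ∎)

  pair-≥ʳ : ∀ a b → b ℕ.≤ pair a b
  pair-≥ʳ a b = ℕ.m≤m+n b _

record Coding (X : Set) : Set where
  field
    encode        : X → ℕ
    decode        : ℕ → X
    decode-encode : ∀ x → decode (encode x) ≡ x

open Coding public

codingℕ : Coding ℕ
codingℕ = record { encode = λ n → n ; decode = λ n → n ; decode-encode = λ _ → refl }

coding⊤ : Coding ⊤
coding⊤ = record { encode = λ _ → 0 ; decode = λ _ → tt ; decode-encode = λ _ → refl }

infixr 2 _×-coding_
infixr 1 _⊎-coding_

_×-coding_ : {X Y : Set} → Coding X → Coding Y → Coding (X × Y)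
cX ×-coding cY = record
  { encode        = λ (x , y) → pair (encode cX x) (encode cY y)
  ; decode        = λ n → decode cX (proj₁ (unpair n)) , decode cY (proj₂ (unpair n))
  ; decode-encode = λ (x , y) → cong₂ _,_
      (trans (cong (λ q → decode cX (proj₁ q)) (unpair-pair (encode cX x) (encode cY y))) (decode-encode cX x))
      (trans (cong (λ q → decode cY (proj₂ q)) (unpair-pair (encode cX x) (encode cY y))) (decode-encode cY y))
  }

_⊎-coding_ : {X Y : Set} → Coding X → Coding Y → Coding (X ⊎ Y)
_⊎-coding_ {X} {Y} cX cY = record
  { encode        = [ (λ x → pair 0 (encode cX x)) , (λ y → pair 1 (encode cY y)) ]′
  ; decode        = λ n → pick (unpair n)
  ; decode-encode = λ { (inj₁ x) → trans (cong pick (unpair-pair 0 (encode cX x))) (cong inj₁ (decode-encode cX x))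
                      ; (inj₂ y) → trans (cong pick (unpair-pair 1 (encode cY y))) (cong inj₂ (decode-encode cY y)) }
  }
  where
  pick : ℕ × ℕ → X ⊎ Y
  pick (zero  , n) = inj₁ (decode cX n)
  pick (suc _ , n) = inj₂ (decode cY n)

-- The length is coded separately so that decoding can recurse on it.
list-coding : {X : Set} → Coding X → Coding (List X)
list-coding {X} cX = record
  { encode        = λ xs → pair (length xs) (enc xs)
  ; decode        = λ n → dec (proj₁ (unpair n)) (proj₂ (unpair n))
  ; decode-encode = λ xs → trans (cong (λ q → dec (proj₁ q) (proj₂ q)) (unpair-pair (length xs) (enc xs))) (dec-enc xs)
  }
  where
  enc : List X → ℕ
  enc []       = 0
  enc (x ∷ xs) = pair (encode cX x) (enc xs)
  dec : ℕ → ℕ → List X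
  dec zero    n = []
  dec (suc k) n = decode cX (proj₁ (unpair n)) ∷ dec k (proj₂ (unpair n))
  dec-enc : ∀ xs → dec (length xs) (enc xs) ≡ xs
  dec-enc []       = refl
  dec-enc (x ∷ xs) = cong₂ _∷_
    (trans (cong (λ q → decode cX (proj₁ q)) (unpair-pair (encode cX x) (enc xs))) (decode-encode cX x))
    (trans (cong (λ q → dec (length xs) (proj₂ q)) (unpair-pair (encode cX x) (enc xs))) (dec-enc xs))

module Least (em : ExcludedMiddle 0ℓ) where
  least : (Q : ℕ → Set) → ∀ n → Q n → Σ ℕ λ m → Q m × (∀ k → Q k → m ℕ.≤ k)
  least Q zero    q = zero , q , λ _ _ → ℕ.z≤n
  least Q (suc n) q with em {Q zero}
  ... | yes q₀ = zero , q₀ , λ _ _ → ℕ.z≤n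
  ... | no ¬q₀ with least (λ k → Q (suc k)) n q
  ...   | m , qm , minimal = suc m , qm , λ { zero q₀ → ⊥-elim (¬q₀ q₀) ; (suc k) qk → ℕ.s≤s (minimal k qk) }

-- Codes for the relations { (n , m) : fⁿ a ≤ fᵐ b } of an order-preserving f.

-- Orbits of one element: inj₁ for increasing ones, inj₂ for decreasing ones,
-- together with the index from which on the orbit is constant, if any.
OrbitCode : Set
OrbitCode = (⊤ ⊎ ℕ) ⊎ (⊤ ⊎ ℕ)

increasing : ⊤ ⊎ ℕ → ℕ → ℕ → Set
increasing (inj₁ _) n m = n ℕ.≤ m
increasing (inj₂ N) n m = n ℕ.≤ m ⊎ N ℕ.≤ m

orbitRel : OrbitCode → ℕ → ℕ → Set
orbitRel (inj₁ c) n m = increasing c n m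
orbitRel (inj₂ c) n m = increasing c m n

-- Two orbits that do not meet: a condition on n − m, possibly negated.
ThresholdCode : Set
ThresholdCode = (⊤ ⊎ ℕ × ℕ) ⊎ (⊤ ⊎ ℕ × ℕ)

threshold : ⊤ ⊎ ℕ × ℕ → ℕ → ℕ → Set
threshold (inj₁ _)       n m = ⊤
threshold (inj₂ (i , j)) n m = n + j ℕ.≤ m + i

thresholdRel : ThresholdCode → ℕ → ℕ → Set
thresholdRel (inj₁ c) n m = threshold c n m
thresholdRel (inj₂ c) n m = ¬ threshold c n m

-- Two orbits with fⁱ a = fʲ b: a finite table and the two orbits.
MeetCode : Set
MeetCode = (ℕ × ℕ) × List (ℕ × ℕ) × OrbitCode × OrbitCode

-- Beyond the meeting point each orbit is a shift of the other, so the comparison takes place in a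
-- single orbit; the table is left with the finitely many pairs before it in both orbits.
meetRel : MeetCode → ℕ → ℕ → Set
meetRel ((i , j) , table , ca , cb) n m = go (i ℕ.≤? n) (j ℕ.≤? m)
  where
  go : Dec (i ℕ.≤ n) → Dec (j ℕ.≤ m) → Set
  go (yes _) _       = orbitRel cb (n ∸ i + j) m
  go (no _)  (yes _) = orbitRel ca n (m ∸ j + i)
  go (no _)  (no _)  = (n , m) ∈ table

PairCode : Set
PairCode = ThresholdCode ⊎ MeetCode

pairRel : PairCode → ℕ → ℕ → Set
pairRel (inj₁ c) = thresholdRel c
pairRel (inj₂ c) = meetRel c

-- If f reverses the order, f ∘ f preserves it: f-orbits are split by parity.
Code : Set
Code = (PairCode × PairCode) × (PairCode × PairCode)

halve : ℕ → Bool × ℕ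
halve zero          = false , zero
halve (suc zero)    = true , zero
halve (suc (suc n)) = proj₁ (halve n) , suc (proj₂ (halve n))

choose : {X : Set} → Bool → X × X → X
choose false = proj₁
choose true  = proj₂

typeRel : Code → ℕ → ℕ → Set
typeRel c n m = pairRel (choose (proj₁ (halve m)) (choose (proj₁ (halve n)) c)) (proj₂ (halve n)) (proj₂ (halve m))

codingCode : Coding Code
codingCode = (pc ×-coding pc) ×-coding (pc ×-coding pc)
  where
  oc : Coding OrbitCode
  oc = (coding⊤ ⊎-coding codingℕ) ⊎-coding (coding⊤ ⊎-coding codingℕ)
  th : Coding (⊤ ⊎ ℕ × ℕ)
  th = coding⊤ ⊎-coding (codingℕ ×-coding codingℕ)
  pc : Coding PairCode
  pc = (th ⊎-coding th) ⊎-coding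
       ((codingℕ ×-coding codingℕ) ×-coding list-coding (codingℕ ×-coding codingℕ) ×-coding oc ×-coding oc)

-- Every pair of orbits has a code

record MonoPreorder {X : Set} (R : X → X → Set) (g : X → X) : Set where
  field
    R-trans : ∀ {x y z} → R x y → R y z → R x z
    R-total : ∀ x y → R x y ⊎ R y x
    R-mono  : ∀ {x y} → R x y → R (g x) (g y)

  iter-mono : ∀ n {x y} → R x y → R (iter g n x) (iter g n y)
  iter-mono zero    q = q
  iter-mono (suc n) q = R-mono (iter-mono n q)

  chain : ∀ {a} → R a (g a) → ∀ {n m} → n ℕ.≤ m → R (iter g n a) (iter g m a)
  chain {a} q n≤m = go (ℕ.≤⇒≤′ n≤m)
    where
    step : ∀ n → R (iter g n a) (iter g (suc n) a)
    step zero    = q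
    step (suc n) = R-mono (step n)
    go : ∀ {n m} → n ℕ.≤′ m → R (iter g n a) (iter g m a)
    go {n} ℕ.≤′-refl   = [ (λ h → h) , (λ h → h) ]′ (R-total (iter g n a) (iter g n a))
    go (ℕ.≤′-step {m} n≤m) = R-trans (go n≤m) (step m)

flip-mono : ∀ {X} {R : X → X → Set} {g} → MonoPreorder R g → MonoPreorder (flip R) g
flip-mono M = record
  { R-trans = λ q q′ → R-trans q′ q ; R-total = λ x y → R-total y x ; R-mono = R-mono }
  where open MonoPreorder M

module TypeCodes (em : ExcludedMiddle 0ℓ) where
  open Least em

  -- Either the orbit rises strictly forever and is ordered like its indices, or there is a least
  -- index at which it stops, and monotonicity keeps it constant from there on.
  increasing-code : ∀ {X} {R : X → X → Set} {g} → MonoPreorder R g → ∀ a → R a (g a) →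
    Σ (⊤ ⊎ ℕ) λ c → ∀ n m → R (iter g n a) (iter g m a) ⇔ increasing c n m
  increasing-code {R = R} {g} M a up with em {Σ ℕ λ N → R (iter g (suc N) a) (iter g N a)}
  ... | no moving = inj₁ tt , λ n m → mk⇔ (only n m) (chain up)
    where
    open MonoPreorder M
    only : ∀ n m → R (iter g n a) (iter g m a) → n ℕ.≤ m
    only n m q with n ℕ.≤? m
    ... | yes n≤m = n≤m
    ... | no n≰m = ⊥-elim (moving (m , R-trans (chain up (ℕ.≰⇒> n≰m)) q))
  ... | yes (N₀ , q₀) with least (λ N → R (iter g (suc N) a) (iter g N a)) N₀ q₀
  ...   | N , qN , minimal = inj₂ N , λ n m → mk⇔ (only n m) [ chain up , stable n m ]′
    where
    open MonoPreorder M
    only : ∀ n m → R (iter g n a) (iter g m a) → n ℕ.≤ m ⊎ N ℕ.≤ m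
    only n m q with n ℕ.≤? m
    ... | yes n≤m = inj₁ n≤m
    ... | no n≰m = inj₂ (minimal m (R-trans (chain up (ℕ.≰⇒> n≰m)) q))
    down : ∀ k → R (iter g (suc (k + N)) a) (iter g (k + N) a)
    down zero    = qN
    down (suc k) = R-mono (down k)
    downs : ∀ k → R (iter g (k + N) a) (iter g N a)
    downs zero    = chain up (ℕ.≤-refl {N})
    downs (suc k) = R-trans (down k) (downs k)
    -- Both terms are compared with the limit value: fⁿ a ≤ fⁿ⁺ᴺ a ≤ fᴺ a ≤ fᵐ a.
    stable : ∀ n m → N ℕ.≤ m → R (iter g n a) (iter g m a)
    stable n m N≤m = R-trans (chain up (ℕ.m≤m+n n N)) (R-trans (downs n) (chain up N≤m))

  orbit-code : ∀ {X} {R : X → X → Set} {g} → MonoPreorder R g → ∀ a →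
    Σ OrbitCode λ c → ∀ n m → R (iter g n a) (iter g m a) ⇔ orbitRel c n m
  orbit-code {g = g} M a with MonoPreorder.R-total M a (g a)
  ... | inj₁ up   = let (c , spec) = increasing-code M a up in inj₁ c , spec
  ... | inj₂ down = let (c , spec) = increasing-code (flip-mono M) a down in inj₂ c , λ n m → spec m n

  climb : ∀ {Q : ℕ → ℕ → Set} → ¬ (Σ ℕ λ n → Σ ℕ λ m → Q n m × ¬ Q (suc n) m) → ∀ n m → Q 0 m → Q n m
  climb no-jump zero    m q = q
  climb {Q} no-jump (suc n) m q =
    decidable-stable em (λ ¬q → no-jump (n , m , climb {Q} no-jump n m q , ¬q))

  -- `Q` depends only on the difference n - m and is downward closed in it. One jump from true to
  -- false therefore determines it, and without a jump it is constant.
  threshold-code : (Q : ℕ → ℕ → Set) → (∀ k n m → Q n m ⇔ Q (k + n) (k + m)) →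
    (∀ {n n′ m} → n ℕ.≤ n′ → Q n′ m → Q n m) →
    Σ ThresholdCode λ c → ∀ n m → Q n m ⇔ thresholdRel c n m
  threshold-code Q diag anti with em {Σ ℕ λ n → Σ ℕ λ m → Q n m × ¬ Q (suc n) m}
  ... | yes (i , j , q , ¬q) = inj₁ (inj₂ (i , j)) , λ n m → mk⇔ (below n m) (above n m)
    where
    -- Shifting (i , j) by `m` and (n , m) by `j` makes the second indices agree, so only the first
    -- ones remain to be compared.
    above : ∀ n m → n + j ℕ.≤ m + i → Q n m
    above n m le = from (diag j n m) (subst₂ Q refl (ℕ.+-comm m j)
      (anti (subst (ℕ._≤ m + i) (ℕ.+-comm n j) le) (to (diag m i j) q)))
    below : ∀ n m → Q n m → n + j ℕ.≤ m + i
    below n m qnm with n + j ℕ.≤? m + i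
    ... | yes le = le
    ... | no ¬le = ⊥-elim (¬q (from (diag m (suc i) j) (subst (Q (m + suc i)) (ℕ.+-comm j m)
      (anti (subst₂ ℕ._≤_ (sym (ℕ.+-suc m i)) (ℕ.+-comm n j) (ℕ.≰⇒> ¬le)) (to (diag j n m) qnm)))))
  ... | no no-jump with em {Q 0 0}
  ...   | yes q₀ = inj₁ (inj₁ tt) , λ n m → mk⇔ (λ _ → tt) (λ _ → always n m)
    where
    always : ∀ n m → Q n m
    always n m = climb {Q} no-jump n m (anti ℕ.z≤n (subst₂ Q (ℕ.+-identityʳ m) (ℕ.+-identityʳ m) (to (diag m 0 0) q₀)))
  ...   | no ¬q₀ = inj₂ (inj₁ tt) , λ n m → mk⇔ (λ q _ → never n m q) (λ absurd → ⊥-elim (absurd tt))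
    where
    never : ∀ n m → ¬ Q n m
    never n m q = ¬q₀ (from (diag m 0 0)
      (subst₂ Q (sym (ℕ.+-identityʳ m)) (sym (ℕ.+-identityʳ m)) (climb {Q} no-jump m m (anti ℕ.z≤n q))))

  module _ {X} {R : X → X → Set} {g} (M : MonoPreorder R g) (a b : X) where
    open MonoPreorder M

    private
      Q : ℕ → ℕ → Set
      Q n m = R (iter g n a) (iter g m b)

    Meet : ℕ × ℕ → Set
    Meet (i , j) = R (iter g i a) (iter g j b) × R (iter g j b) (iter g i a)

    meet-code : ∀ ij → Meet ij → Σ MeetCode λ c → ∀ n m → Q n m ⇔ meetRel c n m
    meet-code (i , j) (q , q′) = ((i , j) , table , proj₁ ca , proj₁ cb) , λ n m → spec n m
      where
      ca = orbit-code M a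
      cb = orbit-code M b
      table : List (ℕ × ℕ)
      table = filter (λ (n , m) → em {Q n m}) (cartesianProduct (upTo i) (upTo j))
      shift : ∀ k → R (iter g (k + i) a) (iter g (k + j) b) × R (iter g (k + j) b) (iter g (k + i) a)
      shift k = subst₂ (λ x y → R x y × R y x) (sym (fold-+ a g k)) (sym (fold-+ b g k))
                  (iter-mono k q , iter-mono k q′)
      shiftᵃ : ∀ n → i ℕ.≤ n → R (iter g n a) (iter g (n ∸ i + j) b) × R (iter g (n ∸ i + j) b) (iter g n a)
      shiftᵃ n i≤n = subst (λ n′ → R (iter g n′ a) (iter g (n ∸ i + j) b) × R (iter g (n ∸ i + j) b) (iter g n′ a))
                       (ℕ.m∸n+n≡m i≤n) (shift (n ∸ i))
      shiftᵇ : ∀ m → j ℕ.≤ m → R (iter g (m ∸ j + i) a) (iter g m b) × R (iter g m b) (iter g (m ∸ j + i) a)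
      shiftᵇ m j≤m = subst (λ m′ → R (iter g (m ∸ j + i) a) (iter g m′ b) × R (iter g m′ b) (iter g (m ∸ j + i) a))
                       (ℕ.m∸n+n≡m j≤m) (shift (m ∸ j))
      spec : ∀ n m → Q n m ⇔ meetRel ((i , j) , table , proj₁ ca , proj₁ cb) n m
      spec n m with i ℕ.≤? n | j ℕ.≤? m
      ... | yes i≤n | _ = mk⇔
        (λ h → to (proj₂ cb _ _) (R-trans (proj₂ (shiftᵃ n i≤n)) h))
        (λ h → R-trans (proj₁ (shiftᵃ n i≤n)) (from (proj₂ cb _ _) h))
      ... | no _ | yes j≤m = mk⇔
        (λ h → to (proj₂ ca _ _) (R-trans h (proj₂ (shiftᵇ m j≤m))))
        (λ h → R-trans (from (proj₂ ca _ _) h) (proj₁ (shiftᵇ m j≤m)))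
      ... | no i≰n | no j≰m = mk⇔
        (λ h → ∈-filter⁺ (λ (n , m) → em {Q n m})
                 (∈-cartesianProduct⁺ (∈-upTo⁺ (ℕ.≰⇒> i≰n)) (∈-upTo⁺ (ℕ.≰⇒> j≰m))) h)
        (λ h → proj₂ (∈-filter⁻ (λ (n , m) → em {Q n m}) {xs = cartesianProduct (upTo i) (upTo j)} h))

    module _ (apart : ¬ Σ (ℕ × ℕ) Meet) where
      -- Forward this is monotonicity. Backward, the opposite inequality would also be shifted
      -- forward, and the orbits would meet at the shifted indices.
      diagonal : ∀ k n m → Q n m ⇔ Q (k + n) (k + m)
      diagonal k n m = mk⇔ (λ q → subst₂ R (sym (fold-+ a g k)) (sym (fold-+ b g k)) (iter-mono k q)) back
        where
        back : Q (k + n) (k + m) → Q n m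
        back q with R-total (iter g n a) (iter g m b)
        ... | inj₁ h = h
        ... | inj₂ h = ⊥-elim (apart ((k + n , k + m) , q ,
                subst₂ R (sym (fold-+ b g k)) (sym (fold-+ a g k)) (iter-mono k h)))

      -- If the orbit of `a` increases, `Q` is downward closed in `n`; if it decreases, the
      -- complement of `Q` is. The negated half of `ThresholdCode` serves the second case.
      apart-code : Σ ThresholdCode λ c → ∀ n m → Q n m ⇔ thresholdRel c n m
      apart-code with R-total a (g a)
      ... | inj₁ up = threshold-code Q diagonal (λ n≤n′ q → R-trans (chain up n≤n′) q)
      ... | inj₂ down with threshold-code (λ n m → ¬ Q n m)
              (λ k n m → mk⇔ (λ ¬q q → ¬q (from (diagonal k n m) q)) (λ ¬q q → ¬q (to (diagonal k n m) q)))
              (λ n≤n′ ¬q q → ¬q (R-trans (MonoPreorder.chain (flip-mono M) down n≤n′) q))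
      ...   | inj₁ c , spec = inj₂ c , λ n m → mk⇔
        (λ q t → from (spec n m) t q)
        (λ ¬t → decidable-stable em (λ ¬q → ¬t (to (spec n m) ¬q)))
      ...   | inj₂ c , spec = inj₁ c , λ n m → mk⇔
        (λ q → decidable-stable em (λ ¬t → from (spec n m) ¬t q))
        (λ t → decidable-stable em (λ ¬q → to (spec n m) ¬q t))

    pair-code : Σ PairCode λ c → ∀ n m → Q n m ⇔ pairRel c n m
    pair-code with em {Σ (ℕ × ℕ) Meet}
    ... | yes (ij , q) = let (c , spec) = meet-code ij q in inj₂ c , spec
    ... | no apart     = let (c , spec) = apart-code apart in inj₁ c , spec

  module _ {s t : Bool} {X : Set} {R : X → X → Set} {g : X → X} {o : X} (pre : IsPre s t R g o) where
    squared : MonoPreorder R (λ x → g (g x))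
    squared = record { R-trans = IsPre.transitive pre ; R-total = IsPre.total pre ; R-mono = go s (IsPre.mono pre) }
      where
      go : ∀ s → (∀ {x y} → R x y → Dir s R (g x) (g y)) → ∀ {x y} → R x y → R (g (g x)) (g (g y))
      go true  m q = m (m q)
      go false m q = m (m q)

    offset : Bool → X → X
    offset false x = x
    offset true  x = g x

    iter-halve : ∀ n x → iter g n x ≡ iter (λ y → g (g y)) (proj₂ (halve n)) (offset (proj₁ (halve n)) x)
    iter-halve zero          x = refl
    iter-halve (suc zero)    x = refl
    iter-halve (suc (suc n)) x = cong (λ y → g (g y)) (iter-halve n x)

    type-code : ∀ a b → Σ Code λ c → ∀ n m → R (iter g n a) (iter g m b) ⇔ typeRel c n m
    type-code a b = code , spec
      where
      part : ∀ e e′ → Σ PairCode _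
      part e e′ = pair-code squared (offset e a) (offset e′ b)
      code : Code
      code = (proj₁ (part false false) , proj₁ (part false true)) , (proj₁ (part true false) , proj₁ (part true true))
      chosen : ∀ e e′ → choose e′ (choose e code) ≡ proj₁ (part e e′)
      chosen false false = refl
      chosen false true  = refl
      chosen true  false = refl
      chosen true  true  = refl
      spec : ∀ n m → R (iter g n a) (iter g m b) ⇔ typeRel code n m
      spec n m rewrite iter-halve n a | iter-halve m b | chosen (proj₁ (halve n)) (proj₁ (halve m)) =
        proj₂ (part (proj₁ (halve n)) (proj₁ (halve m))) _ _

-- Structures with the extension property

fⁿ-+ : ∀ M n m a → fⁿ M (n + m) a ≡ fⁿ M n (fⁿ M m a)
fⁿ-+ M zero    m a = refl
fⁿ-+ M (suc n) m a = cong (f M) (fⁿ-+ M n m a)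

preserving : Kind → Bool
preserving p  = true
preserving sp = true
preserving r  = false
preserving sr = false

strict : Kind → Bool
strict p  = false
strict sp = true
strict r  = false
strict sr = true

module Order (M : Structure) where
  open IsTotalOrder (isLinearOrder M) public
    using (antisym; total) renaming (refl to ≤-refl; trans to ≤-trans; reflexive to ≤-reflexive)

-- On a linear order, strict monotonicity amounts to monotonicity together with reflection of the
-- order. This form also makes sense for preorders.
record Laws (k : Kind) (M : Structure) : Set where
  field
    mono   : ∀ {a b} → _≤_ M a b → Dir (preserving k) (_≤_ M) (f M a) (f M b)
    cancel : T (strict k) → ∀ {a b} → Dir (preserving k) (_≤_ M) (f M a) (f M b) → _≤_ M a b

laws⇒base : ∀ k M → Laws k M → BaseCond k M
laws⇒base p  M L a b = Laws.mono L
laws⇒base sp M L a b (a≤b , a≢b) = Laws.mono L a≤b ,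
  λ e → a≢b (antisym a≤b (Laws.cancel L tt (≤-reflexive (sym e))))
  where open Order M
laws⇒base r  M L a b = Laws.mono L
laws⇒base sr M L a b (a≤b , a≢b) = Laws.mono L a≤b ,
  λ e → a≢b (antisym a≤b (Laws.cancel L tt (≤-reflexive (sym e))))
  where open Order M

base⇒laws : ExcludedMiddle 0ℓ → ∀ k M → BaseCond k M → Laws k M
base⇒laws em p  M c = record { mono = c _ _ ; cancel = λ () }
base⇒laws em r  M c = record { mono = c _ _ ; cancel = λ () }
base⇒laws em sp M c = record { mono = λ {a} {b} → mono a b ; cancel = λ _ {a} {b} → cancel a b }
  where
  open Order M
  mono : ∀ a b → _≤_ M a b → _≤_ M (f M a) (f M b)
  mono a b q with em {a ≡ b}
  ... | yes refl = ≤-refl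
  ... | no a≢b   = proj₁ (c a b (q , a≢b))
  cancel : ∀ a b → _≤_ M (f M a) (f M b) → _≤_ M a b
  cancel a b q with em {b ≡ a} | total a b
  ... | yes refl | _      = ≤-refl
  ... | no _     | inj₁ q′ = q′
  ... | no b≢a   | inj₂ q′ with c b a (q′ , b≢a)
  ...   | q″ , ne = ⊥-elim (ne (antisym q″ q))
base⇒laws em sr M c = record { mono = λ {a} {b} → mono a b ; cancel = λ _ {a} {b} → cancel a b }
  where
  open Order M
  mono : ∀ a b → _≤_ M a b → _≤_ M (f M b) (f M a)
  mono a b q with em {a ≡ b}
  ... | yes refl = ≤-refl
  ... | no a≢b   = proj₁ (c a b (q , a≢b))
  cancel : ∀ a b → _≤_ M (f M b) (f M a) → _≤_ M a b
  cancel a b q with em {b ≡ a} | total a b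
  ... | yes refl | _      = ≤-refl
  ... | no _     | inj₁ q′ = q′
  ... | no b≢a   | inj₂ q′ with c b a (q′ , b≢a)
  ...   | q″ , ne = ⊥-elim (ne (antisym q″ q))

-- Satisfaction of φ by a, where Q i j stands for fⁱ a ≤ fʲ a.
Holds : (ℕ → ℕ → Set) → QF → Set
Holds Q (eqA n m)  = Q n m × Q m n
Holds Q (leA n m)  = Q n m
Holds Q falseF     = ⊥
Holds Q trueF      = ⊤
Holds Q (notF φ)   = ¬ Holds Q φ
Holds Q (andF φ ψ) = Holds Q φ × Holds Q ψ
Holds Q (orF φ ψ)  = Holds Q φ ⊎ Holds Q ψ
Holds Q (impF φ ψ) = Holds Q φ → Holds Q ψ

-- Through this, the conditions in `H` pass between structures: only the order among the iterates of
-- a single element matters.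
holds-cong : ∀ {Q Q′} → (∀ i j → Q i j ⇔ Q′ i j) → ∀ φ → Holds Q φ ⇔ Holds Q′ φ
holds-cong e (eqA n m)  = mk⇔ (λ (x , y) → to (e n m) x , to (e m n) y) (λ (x , y) → from (e n m) x , from (e m n) y)
holds-cong e (leA n m)  = e n m
holds-cong e falseF     = mk⇔ (λ x → x) (λ x → x)
holds-cong e trueF      = mk⇔ (λ x → x) (λ x → x)
holds-cong e (notF φ)   = mk⇔ (λ n x → n (from (holds-cong e φ) x)) (λ n x → n (to (holds-cong e φ) x))
holds-cong e (andF φ ψ) = mk⇔ (λ (x , y) → to (holds-cong e φ) x , to (holds-cong e ψ) y)
                              (λ (x , y) → from (holds-cong e φ) x , from (holds-cong e ψ) y)
holds-cong e (orF φ ψ)  = mk⇔ (Sum.map (to (holds-cong e φ)) (to (holds-cong e ψ)))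
                              (Sum.map (from (holds-cong e φ)) (from (holds-cong e ψ)))
holds-cong e (impF φ ψ) = mk⇔ (λ h x → to (holds-cong e ψ) (h (from (holds-cong e φ) x)))
                              (λ h x → from (holds-cong e ψ) (h (to (holds-cong e φ) x)))

sat⇔holds : ∀ M a φ → Sat M φ a ⇔ Holds (λ i j → _≤_ M (fⁿ M i a) (fⁿ M j a)) φ
sat⇔holds M a (eqA n m)  = mk⇔ (λ e → ≤-reflexive e , ≤-reflexive (sym e)) (λ (x , y) → antisym x y)
  where open Order M
sat⇔holds M a (leA n m)  = mk⇔ (λ x → x) (λ x → x)
sat⇔holds M a falseF     = mk⇔ (λ x → x) (λ x → x)
sat⇔holds M a trueF      = mk⇔ (λ x → x) (λ x → x)
sat⇔holds M a (notF φ)   = mk⇔ (λ n x → n (from (sat⇔holds M a φ) x)) (λ n x → n (to (sat⇔holds M a φ) x))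
sat⇔holds M a (andF φ ψ) = mk⇔ (λ (x , y) → to (sat⇔holds M a φ) x , to (sat⇔holds M a ψ) y)
                               (λ (x , y) → from (sat⇔holds M a φ) x , from (sat⇔holds M a ψ) y)
sat⇔holds M a (orF φ ψ)  = mk⇔ (Sum.map (to (sat⇔holds M a φ)) (to (sat⇔holds M a ψ)))
                               (Sum.map (from (sat⇔holds M a φ)) (from (sat⇔holds M a ψ)))
sat⇔holds M a (impF φ ψ) = mk⇔ (λ h x → to (sat⇔holds M a ψ) (h (from (sat⇔holds M a φ) x)))
                               (λ h x → from (sat⇔holds M a ψ) (h (to (sat⇔holds M a φ) x)))

-- x ↦ y extends to an isomorphism of the generated substructures.
SameType : (M A : Structure) (x x′ : Carrier M) (y y′ : Carrier A) → Set
SameType M A x x′ y y′ = ∀ n m → _≤_ M (fⁿ M n x) (fⁿ M m x′) ⇔ _≤_ A (fⁿ A n y) (fⁿ A m y′)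

same-iterates : ∀ M A {x x′ y y′} i j → SameType M A x x′ y y′ →
  SameType M A (fⁿ M i x) (fⁿ M j x′) (fⁿ A i y) (fⁿ A j y′)
same-iterates M A {x} {x′} {y} {y′} i j e n m =
  subst₂ _⇔_ (cong₂ (_≤_ M) (fⁿ-+ M n i x) (fⁿ-+ M m j x′)) (cong₂ (_≤_ A) (fⁿ-+ A n i y) (fⁿ-+ A m j y′))
    (e (n + i) (m + j))

-- Checking pairs suffices for a finite partial isomorphism, since an atomic formula involves at
-- most two generators.
Matched : (M A : Structure) → List (Carrier M × Carrier A) → Set
Matched M A ps = ∀ {x y x′ y′} → (x , y) ∈ ps → (x′ , y′) ∈ ps → SameType M A x x′ y y′

matched-swap : ∀ {M A ps} → Matched M A ps → Matched A M (List.map swap ps)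
matched-swap {ps = ps} h q q′ n m with ∈-map⁻ swap q | ∈-map⁻ swap q′
... | _ , i , refl | _ , i′ , refl = ⇔-sym (h i i′ n m)

matched-unswap : ∀ {M A ps x y} → Matched A M ((y , x) ∷ List.map swap ps) → Matched M A ((x , y) ∷ ps)
matched-unswap {ps = ps} h q q′ n m = ⇔-sym (h (exchange q) (exchange q′) n m)
  where
  exchange : ∀ {u v x y} → (u , v) ∈ (x , y) ∷ ps → (v , u) ∈ (y , x) ∷ List.map swap ps
  exchange (here refl) = here refl
  exchange (there i) = there (∈-map⁺ swap i)

same-type⇒≡ : ∀ M A {x x′ y y′} → SameType M A x x′ y y′ → SameType M A x′ x y′ y → y ≡ y′ → x ≡ x′
same-type⇒≡ M A e e′ refl = antisym (from (e 0 0) (Order.≤-refl A)) (from (e′ 0 0) (Order.≤-refl A))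
  where open Order M

embed : ∀ A M (h : Carrier A → Carrier M) → (∀ a b → SameType M A (h a) (h b) a b) → Embedding A M
embed A M h same = record
  { map       = h
  ; injective = λ {a} {b} e → Order.antisym A (to (same a b 0 0) (Order.≤-reflexive M e))
                                              (to (same b a 0 0) (Order.≤-reflexive M (sym e)))
  ; pres-f    = λ a → Order.antisym M (from (same (f A a) a 0 1) (Order.≤-refl A))
                                      (from (same a (f A a) 1 0) (Order.≤-refl A))
  ; pres-≤    = λ a b → ⇔-sym (same a b 0 0)
  }

map-fⁿ : ∀ {A M} (e : Embedding A M) n a → map e (fⁿ A n a) ≡ fⁿ M n (map e a)
map-fⁿ e zero    a = refl
map-fⁿ {A} {M} e (suc n) a = trans (pres-f e (fⁿ A n a)) (cong (f M) (map-fⁿ e n a))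

embedding-same : ∀ {A M} (e : Embedding A M) a b → SameType M A (map e a) (map e b) a b
embedding-same {A} {M} e a b n m =
  ⇔-sym (subst₂ (λ u v → _≤_ A (fⁿ A n a) (fⁿ A m b) ⇔ _≤_ M u v) (map-fⁿ e n a) (map-fⁿ e m b) (pres-≤ e _ _))

KH-substructure : ExcludedMiddle 0ℓ → ∀ {k H A M} → Embedding A M → KH k H M → KH k H A
KH-substructure em {k} {H} {A} {M} e (base , models) = laws⇒base k A laws , λ φ h a →
  from (sat⇔holds A a φ) (to (holds-cong (embedding-same e a a) φ) (to (sat⇔holds M (map e a) φ) (models φ h (map e a))))
  where
  L = base⇒laws em k M base
  dir : ∀ d a b → Dir d (_≤_ A) (f A a) (f A b) ⇔ Dir d (_≤_ M) (f M (map e a)) (f M (map e b))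
  dir true  a b = ⇔-sym (embedding-same e a b 1 1)
  dir false a b = ⇔-sym (embedding-same e b a 1 1)
  laws : Laws k A
  laws = record
    { mono   = λ {a} {b} q → from (dir (preserving k) a b) (Laws.mono L (to (pres-≤ e a b) q))
    ; cancel = λ w {a} {b} q → from (pres-≤ e a b) (Laws.cancel L w (to (dir (preserving k) a b) q))
    }

-- The substructure to be extended is given by matched finite lists of generators. `A` may be any
-- member of the class, in particular `M` itself, as back and forth requires.
Extension : Kind → Conditions → Structure → Set₁
Extension k H M = ∀ A → KH k H A → ∀ ps → Matched M A ps → ∀ b → Σ (Carrier M) λ x → Matched M A ((x , b) ∷ ps)

-- Back and forth from the extension property

module Limit (em : ExcludedMiddle 0ℓ) {k : Kind} {H : Conditions} (M : Structure) (M∈K : KH k H M)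
  (countable : Countable (Carrier M)) (extend : Extension k H M) where

  private
    X = Carrier M

  realise : ∀ A → KH k H A → (gs : List (Carrier A)) →
    Σ (List (X × Carrier A)) λ ps → Matched M A ps × (∀ {g} → g ∈ gs → Σ X λ x → (x , g) ∈ ps)
  realise A A∈K []       = [] , (λ ()) , λ ()
  realise A A∈K (g ∷ gs) with realise A A∈K gs
  ... | ps , h , cover with extend A A∈K ps h g
  ...   | x , h′ = (x , g) ∷ ps , h′ , λ { (here refl) → x , here refl
                                        ; (there i) → proj₁ (cover i) , there (proj₂ (cover i)) }

  age⊇ : ∀ A → KHfg k H A → Embeds A M
  age⊇ A ((gs , gen) , A∈K) with realise A A∈K gs
  ... | ps , h , cover = embed A M image same
    where
    source : ∀ a → Σ X λ x → (x , proj₁ (gen a)) ∈ ps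
    source a = cover (proj₁ (proj₂ (gen a)))
    power : Carrier A → ℕ
    power a = proj₁ (proj₂ (proj₂ (gen a)))
    image : Carrier A → X
    image a = fⁿ M (power a) (proj₁ (source a))
    same : ∀ a b → SameType M A (image a) (image b) a b
    same a b = subst₂ (SameType M A (image a) (image b))
      (sym (proj₂ (proj₂ (proj₂ (gen a))))) (sym (proj₂ (proj₂ (proj₂ (gen b)))))
      (same-iterates M A (power a) (power b) (h (proj₂ (source a)) (proj₂ (source b))))

  age : AgeIs M (KHfg k H)
  age A = mk⇔ (λ (fg , e) → fg , KH-substructure em e M∈K) (λ A∈K → proj₁ A∈K , age⊇ A A∈K)

  State : Set
  State = Σ (List (X × X)) (Matched M M)

  forth : (S : State) → ∀ b → Σ X λ x → Matched M M ((x , b) ∷ proj₁ S)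
  forth (ps , h) = extend M M∈K ps h

  back : (S : State) → ∀ a → Σ X λ y → Matched M M ((a , y) ∷ proj₁ S)
  back (ps , h) a with extend M M∈K (List.map swap ps) (matched-swap {M} {M} h) a
  ... | y , h′ = y , matched-unswap {M} {M} h′

  addˡ addʳ : State → X → State
  addˡ S a = (a , proj₁ (back S a)) ∷ proj₁ S , proj₂ (back S a)
  addʳ S b = (proj₁ (forth S b) , b) ∷ proj₁ S , proj₂ (forth S b)

  -- Step `n` puts the element numbered `n` both into the domain and into the range; numbers of no
  -- element change nothing.
  step : State → ℕ → State
  step S n with em {Σ X λ a → proj₁ countable a ≡ n}
  ... | no _ = S
  ... | yes (a , _) = addʳ (addˡ S a) a

  step-⊆ : ∀ S n {q} → q ∈ proj₁ S → q ∈ proj₁ (step S n)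
  step-⊆ S n i with em {Σ X λ a → proj₁ countable a ≡ n}
  ... | no _  = i
  ... | yes _ = there (there i)

  step-covers : ∀ S a → (Σ X λ y → (a , y) ∈ proj₁ (step S (proj₁ countable a))) ×
                        (Σ X λ x → (x , a) ∈ proj₁ (step S (proj₁ countable a)))
  step-covers S a with em {Σ X λ a′ → proj₁ countable a′ ≡ proj₁ countable a}
  ... | no ¬q = ⊥-elim (¬q (a , refl))
  ... | yes (a′ , e) with proj₂ countable e
  ...   | refl = (_ , there (here refl)) , (_ , here refl)

  module BackAndForth (S₀ : State) where
    states : ℕ → State
    states zero    = S₀
    states (suc n) = step (states n) n

    states-⊆ : ∀ d n {q} → q ∈ proj₁ (states n) → q ∈ proj₁ (states (d + n))
    states-⊆ zero    n i = i
    states-⊆ (suc d) n i = step-⊆ (states (d + n)) (d + n) (states-⊆ d n i)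

    Related : X → X → Set
    Related x y = Σ ℕ λ n → (x , y) ∈ proj₁ (states n)

    related-same : ∀ {x y x′ y′} → Related x y → Related x′ y′ → SameType M M x x′ y y′
    related-same {x′ = x′} {y′} (n , i) (n′ , i′) = proj₂ (states (n′ + n)) (states-⊆ n′ n i)
      (subst (λ m → (x′ , y′) ∈ proj₁ (states m)) (ℕ.+-comm n n′) (states-⊆ n n′ i′))

    image : ∀ a → Σ X (Related a)
    image a = let (y , i) = proj₁ (step-covers (states (proj₁ countable a)) a) in y , suc (proj₁ countable a) , i

    preimage : ∀ b → Σ X λ x → Related x b
    preimage b = let (x , i) = proj₂ (step-covers (states (proj₁ countable b)) b) in x , suc (proj₁ countable b) , i

    functional : ∀ {x y x′ y′} → Related x y → Related x′ y′ → x ≡ x′ → y ≡ y′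
    functional q q′ e = same-type⇒≡ M M (λ n m → ⇔-sym (related-same q q′ n m)) (λ n m → ⇔-sym (related-same q′ q n m)) e

    automorphism : Automorphism M
    automorphism = record
      { emb = embed M M (λ a → proj₁ (image a))
                (λ a b n m → ⇔-sym (related-same (proj₂ (image a)) (proj₂ (image b)) n m))
      ; surjective = λ b → proj₁ (preimage b) , λ { refl → functional (proj₂ (image _)) (proj₂ (preimage b)) refl }
      }

  homogeneous : Ultrahomogeneous M
  homogeneous A (gs , gen) e₁ e₂ = automorphism , agree
    where
    ps : List (X × X)
    ps = List.map (λ g → map e₁ g , map e₂ g) gs
    start : Matched M M ps
    start q q′ n m with ∈-map⁻ _ q | ∈-map⁻ _ q′
    ... | g , _ , refl | g′ , _ , refl = ⇔-sym (embedding-same e₂ g g′ n m) ⇔-∘ embedding-same e₁ g g′ n m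
    open BackAndForth (ps , start)
    agree : ∀ a → proj₁ (image (map e₁ a)) ≡ map e₂ a
    agree a with gen a
    ... | g , g∈gs , n , refl =
      -- The generator pair belongs to the initial state, so the value at the n-th iterate of
      -- `map e₁ g` has the same type over `map e₂ g` as the n-th iterate of `map e₂ g`, and equals
      -- it.
      trans (same-type⇒≡ M M (λ i j → ⇔-sym (one i j)) (λ i j → ⇔-sym (two i j)) (map-fⁿ e₁ n g)) (sym (map-fⁿ e₂ n g))
      where
      gen-related : Related (map e₁ g) (map e₂ g)
      gen-related = 0 , ∈-map⁺ (λ g → map e₁ g , map e₂ g) g∈gs
      here-related = proj₂ (image (map e₁ (fⁿ A n g)))
      one = same-iterates M M 0 n (related-same here-related gen-related)
      two = same-iterates M M n 0 (related-same gen-related here-related)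

  isFraïsséLimit : IsFraisseLimit (KHfg k H) M
  isFraïsséLimit = countable , homogeneous , age

-- The generic chain

-- The pointed prestructure of a structure A: the point is a largest element if the
-- operation preserves the order, and a fixed point if it reverses the order.
module Pointed (A : Structure) where
  open Order A

  -- For an order-reversing operation, a ≤ f a holds exactly for the elements below a fixed point.
  -- The comparison thus places the point even if no fixed point exists, and identifies it with the
  -- fixed point if there is one.
  data PointedOrder : Bool → Maybe (Carrier A) → Maybe (Carrier A) → Set where
    inside : ∀ {s a b} → _≤_ A a b → PointedOrder s (just a) (just b)
    under  : ∀ {a} → PointedOrder true (just a) nothing
    before : ∀ {a} → _≤_ A a (f A a) → PointedOrder false (just a) nothing
    after  : ∀ {b} → _≤_ A (f A b) b → PointedOrder false nothing (just b)
    point  : ∀ {s} → PointedOrder s nothing nothing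

  g : Maybe (Carrier A) → Maybe (Carrier A)
  g = Maybe.map (f A)

  iter-just : ∀ n a → iter g n (just a) ≡ just (fⁿ A n a)
  iter-just zero    a = refl
  iter-just (suc n) a = cong g (iter-just n a)

  isPre : ∀ s t → (∀ {a b} → _≤_ A a b → Dir s (_≤_ A) (f A a) (f A b)) →
    (T t → ∀ {a b} → Dir s (_≤_ A) (f A a) (f A b) → _≤_ A a b) → IsPre s t (PointedOrder s) g nothing
  isPre true t mono cancel = record
    { transitive = tr ; total = tot ; mono = mon ; cancel = λ w {x} {y} → can w x y
    ; fix≤ = point ; fix≥ = point ; top = λ { _ (just _) → under ; _ nothing → point } }
    where
    R = PointedOrder true
    tr : ∀ {x y z} → R x y → R y z → R x z
    tr (inside q) (inside q′) = inside (≤-trans q q′)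
    tr (inside _) under       = under
    tr under      point       = under
    tr point      q           = q
    tot : ∀ x y → R x y ⊎ R y x
    tot (just a) (just b) = Sum.map inside inside (total a b)
    tot (just _) nothing  = inj₁ under
    tot nothing  (just _) = inj₂ under
    tot nothing  nothing  = inj₁ point
    mon : ∀ {x y} → R x y → R (g x) (g y)
    mon (inside q) = inside (mono q)
    mon under      = under
    mon point      = point
    can : T t → ∀ x y → R (g x) (g y) → R x y
    can w (just _) (just _) (inside q) = inside (cancel w q)
    can w (just _) nothing  under      = under
    can w nothing  nothing  point      = point
  isPre false t mono cancel = record
    { transitive = tr ; total = tot ; mono = mon ; cancel = λ w {x} {y} → can w x y
    ; fix≤ = point ; fix≥ = point ; top = λ () }
    where
    R = PointedOrder false
    tr : ∀ {x y z} → R x y → R y z → R x z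
    tr (inside q) (inside q′) = inside (≤-trans q q′)
    tr (inside q) (before q′) = before (≤-trans q (≤-trans q′ (mono q)))
    -- If b ≤ a, reversal still yields a ≤ f a ≤ f b ≤ b.
    tr (before {a} q) (after {b} q′) with total a b
    ... | inj₁ a≤b = inside a≤b
    ... | inj₂ b≤a = inside (≤-trans q (≤-trans (mono b≤a) q′))
    tr (before q) point       = before q
    tr (after q)  (inside q′) = after (≤-trans (mono q′) (≤-trans q q′))
    tr (after q)  (before q′) = point
    tr point      q           = q
    tot : ∀ x y → R x y ⊎ R y x
    tot (just a) (just b) = Sum.map inside inside (total a b)
    tot (just a) nothing  = Sum.map before after (total a (f A a))
    tot nothing  (just b) = Sum.map after before (total (f A b) b)
    tot nothing  nothing  = inj₁ point
    mon : ∀ {x y} → R x y → R (g y) (g x)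
    mon (inside q) = inside (mono q)
    mon (before q) = after (mono q)
    mon (after q)  = before (mono q)
    mon point      = point
    can : T t → ∀ x y → R (g y) (g x) → R x y
    can w (just _) (just _) (inside q) = inside (cancel w q)
    can w (just _) nothing  (after q)  = before (cancel w q)
    can w nothing  (just _) (before q) = after (cancel w q)
    can w nothing  nothing  point      = point

g-≈ : ∀ {s t X} {R : X → X → Set} {g o} → IsPre s t R g o → ∀ {x y} → R x y × R y x → R (g x) (g y) × R (g y) (g x)
g-≈ {true}  pre (q , q′) = IsPre.mono pre q , IsPre.mono pre q′
g-≈ {false} pre (q , q′) = IsPre.mono pre q′ , IsPre.mono pre q

iter-≈ : ∀ {s t X} {R : X → X → Set} {g o} → IsPre s t R g o → ∀ n {x y} → R x y × R y x →
  R (iter g n x) (iter g n y) × R (iter g n y) (iter g n x)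
iter-≈ pre zero    e = e
iter-≈ pre (suc n) e = g-≈ pre (iter-≈ pre n e)

≈-cong : ∀ {s t X} {R : X → X → Set} {g o} → IsPre s t R g o → ∀ {x x′ y y′} →
  R x x′ × R x′ x → R y y′ × R y′ y → R x y ⇔ R x′ y′
≈-cong pre (a , b) (c , d) = mk⇔ (λ q → M.transitive b (M.transitive q c)) (λ q → M.transitive a (M.transitive q d))
  where module M = IsPre pre

below-point : ∀ {t X} {R : X → X → Set} {g o} → IsPre false t R g o → ∀ x → R x o ⇔ R x (g x)
below-point {R = R} {g} {o} pre x = mk⇔ (λ q → M.transitive q (M.transitive M.fix≥ (M.mono q))) back
  where
  module M = IsPre pre
  back : R x (g x) → R x o
  back q with M.total x o
  ... | inj₁ q′ = q′
  ... | inj₂ q′ = M.transitive q (M.transitive (M.mono q′) M.fix≤)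

above-point : ∀ {t X} {R : X → X → Set} {g o} → IsPre false t R g o → ∀ x → R o x ⇔ R (g x) x
above-point {R = R} {g} {o} pre x = mk⇔ (λ q → M.transitive (M.mono q) (M.transitive M.fix≤ q)) back
  where
  module M = IsPre pre
  back : R (g x) x → R o x
  back q with M.total x o
  ... | inj₁ q′ = M.transitive M.fix≥ (M.transitive (M.mono q′) q)
  ... | inj₂ q′ = q′

-- The type of an element over the point is determined by its own orbit: in the preserving case the
-- point is strictly above, in the reversing case `below-point` and `above-point` apply. Hence the
-- point can join any partial isomorphism.
point-same : ∀ s {t X X′} {R : X → X → Set} {g o} {R′ : X′ → X′ → Set} {g′ o′} →
  IsPre s t R g o → IsPre s t R′ g′ o′ → ∀ {x x′} →
  (∀ i j → R (iter g i x) (iter g j x) ⇔ R′ (iter g′ i x′) (iter g′ j x′)) →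
  (T s → ∀ n → ¬ R o (iter g n x)) → (T s → ∀ n → ¬ R′ o′ (iter g′ n x′)) →
  ∀ n → (R (iter g n x) o ⇔ R′ (iter g′ n x′) o′) × (R o (iter g n x) ⇔ R′ o′ (iter g′ n x′))
point-same true pre pre′ e l l′ n =
  mk⇔ (λ _ → IsPre.top pre′ tt _) (λ _ → IsPre.top pre tt _) ,
  mk⇔ (λ q → ⊥-elim (l tt n q)) (λ q → ⊥-elim (l′ tt n q))
point-same false pre pre′ e _ _ n =
  ⇔-sym (below-point pre′ _) ⇔-∘ (e n (suc n) ⇔-∘ below-point pre _) ,
  ⇔-sym (above-point pre′ _) ⇔-∘ (e (suc n) n ⇔-∘ above-point pre _)

pullback : ∀ {s t X X′} {R : X → X → Set} {g o} {R′ : X′ → X′ → Set} {g′ o′} → IsPre s t R g o →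
  (ev : X′ → X) → (∀ x → ev (g′ x) ≡ g (ev x)) → ev o′ ≡ o → (∀ x y → R′ x y ⇔ R (ev x) (ev y)) →
  IsPre s t R′ g′ o′
pullback {s} {R = R} {g} {R′ = R′} {g′} pre ev ev-g refl e = record
  { transitive = λ q q′ → from (e _ _) (M.transitive (to (e _ _) q) (to (e _ _) q′))
  ; total  = λ x y → Sum.map (from (e x y)) (from (e y x)) (M.total (ev x) (ev y))
  ; mono   = λ q → from (dir s) (M.mono (to (e _ _) q))
  ; cancel = λ w q → from (e _ _) (M.cancel w (to (dir s) q))
  ; fix≤   = from (e _ _) (subst (λ x → R x _) (sym (ev-g _)) M.fix≤)
  ; fix≥   = from (e _ _) (subst (λ x → R _ x) (sym (ev-g _)) M.fix≥)
  ; top    = λ w x → from (e x _) (M.top w (ev x))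
  }
  where
  module M = IsPre pre
  dir : ∀ d {x y} → Dir d R′ (g′ x) (g′ y) ⇔ Dir d R (g (ev x)) (g (ev y))
  dir true  {x} {y} = subst₂ (λ u v → R′ (g′ x) (g′ y) ⇔ R u v) (ev-g x) (ev-g y) (e (g′ x) (g′ y))
  dir false {x} {y} = subst₂ (λ u v → R′ (g′ y) (g′ x) ⇔ R u v) (ev-g y) (ev-g x) (e (g′ y) (g′ x))

-- The term (i , n) stands for fⁿ applied to the i-th generator; generator 0 is the point.
Term : Set
Term = ℕ × ℕ

next : Term → Term
next t = proj₁ t , suc (proj₂ t)

origin : Term
origin = 0 , 0

iter-next : ∀ i n → iter next n (i , 0) ≡ (i , n)
iter-next i zero    = refl
iter-next i (suc n) = cong next (iter-next i n)

iter-next-gen : ∀ n t → proj₁ (iter next n t) ≡ proj₁ t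
iter-next-gen zero    t = refl
iter-next-gen (suc n) t = iter-next-gen n t

eval : {X : Set} → (X → X) → (ℕ → X) → Term → X
eval g gens t = iter g (proj₂ t) (gens (proj₁ t))

eval-iter : ∀ {X} (g : X → X) gens n t → eval g gens (iter next n t) ≡ iter g n (eval g gens t)
eval-iter g gens zero    t = refl
eval-iter g gens (suc n) t = cong g (eval-iter g gens n t)

iter-inj₁ : ∀ {X Y} (g : X → X) (h : Y → Y) n x → iter (Sum.map g h) n (inj₁ x) ≡ inj₁ (iter g n x)
iter-inj₁ g h zero    x = refl
iter-inj₁ g h (suc n) x = cong (Sum.map g h) (iter-inj₁ g h n x)

iter-inj₂ : ∀ {X Y} (g : X → X) (h : Y → Y) n y → iter (Sum.map g h) n (inj₂ y) ≡ inj₂ (iter h n y)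
iter-inj₂ g h zero    y = refl
iter-inj₂ g h (suc n) y = cong (Sum.map g h) (iter-inj₂ g h n y)

module Quotient (em : ExcludedMiddle 0ℓ) {X : Set} (code : X → ℕ) (_≈_ : X → X → Set)
  (≈-reflexive : ∀ {x y} → code x ≡ code y → x ≈ y) (≈-sym : ∀ {x y} → x ≈ y → y ≈ x)
  (≈-trans : ∀ {x y z} → x ≈ y → y ≈ z → x ≈ z) where
  open Least em

  abstract
    -- The canonical name of a class is the least code of its members.
    coded : ∀ x → Σ ℕ λ n → (Σ X λ y → code y ≡ n × y ≈ x) × (∀ k → (Σ X λ y → code y ≡ k × y ≈ x) → n ℕ.≤ k)
    coded x = least (λ n → Σ X λ y → code y ≡ n × y ≈ x) (code x) (x , refl , ≈-reflexive refl)

    class : X → ℕ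
    class x = proj₁ (coded x)

    class-cong : ∀ {x y} → x ≈ y → class x ≡ class y
    class-cong {x} {y} e = ℕ.≤-antisym (below e) (below (≈-sym e))
      where
      below : ∀ {x y} → x ≈ y → class x ℕ.≤ class y
      below {x} {y} e = let (z , cz , z≈y) = proj₁ (proj₂ (coded y))
                        in proj₂ (proj₂ (coded x)) (class y) (z , cz , ≈-trans z≈y (≈-sym e))

    class-sound : ∀ {x y} → class x ≡ class y → x ≈ y
    class-sound {x} {y} e =
      let (u , cu , u≈x) = proj₁ (proj₂ (coded x)) ; (v , cv , v≈y) = proj₁ (proj₂ (coded y))
      in ≈-trans (≈-sym u≈x) (≈-trans (≈-reflexive (trans cu (trans e (sym cv)))) v≈y)

    -- A subset of ℕ; `True` makes membership proof-irrelevant, so elements with equal index are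
    -- equal.
    Quot : Set
    Quot = Σ ℕ λ n → True (em {Σ X λ x → class x ≡ n})

    index : Quot → ℕ
    index = proj₁

    quot-≡ : ∀ {a b : Quot} → index a ≡ index b → a ≡ b
    quot-≡ {n , _} refl = cong (n ,_) (T-irrelevant _ _)

    [_] : X → Quot
    [ x ] = class x , fromWitness (x , refl)

    rep : Quot → X
    rep (_ , w) = proj₁ (toWitness w)

    rep-[] : ∀ x → rep [ x ] ≈ x
    rep-[] x = class-sound (proj₂ (toWitness (proj₂ [ x ])))

    ≈⇒≡ : ∀ {a b} → rep a ≈ rep b → a ≡ b
    ≈⇒≡ {a} {b} e = quot-≡ (trans (sym (proj₂ (toWitness (proj₂ a)))) (trans (class-cong e) (proj₂ (toWitness (proj₂ b)))))

-- The stages: one problem at a time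

module Construction (em : ExcludedMiddle 0ℓ) (k : Kind) (H : Conditions) where
  open TypeCodes em

  private
    s = preserving k
    t = strict k

  -- The shift by `n` demands `H` of the whole orbit of `x`. The point is exempt, as a fixed point
  -- may violate `H`.
  record Good {X : Set} (R : X → X → Set) (g : X → X) (o x : X) : Set where
    field
      models  : ∀ φ → H φ → ∀ n → Holds (λ i j → R (iter g (i + n) x) (iter g (j + n) x)) φ
      not-top : T s → ∀ n → ¬ R o (iter g n x)

  good-cong : ∀ {X X′} {R : X → X → Set} {g o x} {R′ : X′ → X′ → Set} {g′ o′ x′} →
    (∀ i j → R (iter g i x) (iter g j x) ⇔ R′ (iter g′ i x′) (iter g′ j x′)) →
    (∀ n → R o (iter g n x) ⇔ R′ o′ (iter g′ n x′)) → Good R g o x → Good R′ g′ o′ x′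
  good-cong e e′ G = record
    { models  = λ φ h n → to (holds-cong (λ i j → e (i + n) (j + n)) φ) (Good.models G φ h n)
    ; not-top = λ w n q → Good.not-top G w n (from (e′ n) q)
    }

  -- (x , c , c′) ∈ proj₁ q asks for an element b such that c and c′ are the codes of
  -- the types of (b , x) and (x , b); proj₂ q is to be the code of the type of (b , b).
  Problem : Set
  Problem = List (Term × Code × Code) × Code

  codingProblem : Coding Problem
  codingProblem = list-coding ((codingℕ ×-coding codingℕ) ×-coding codingCode ×-coding codingCode) ×-coding codingCode

  -- Generator 1 of B solves the problem; P is the partial isomorphism along which
  -- B is to be amalgamated.
  record Solves (R : Term → Term → Set) (q : Problem) (B P : Term → Term → Set) : Set where
    field
      isPre  : IsPre s t B next origin
      good   : Good B next origin (1 , 0)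
      P-o    : P origin origin
      P-next : ∀ {x y} → P x y → P (next x) (next y)
      P-iso  : ∀ {x y x′ y′} → P x y → P x′ y′ → R x x′ ⇔ B y y′
      self   : ∀ n m → B (iter next n (1 , 0)) (iter next m (1 , 0)) ⇔ typeRel (proj₂ q) n m
      pairs  : ∀ {x c c′} → (x , c , c′) ∈ proj₁ q → Σ Term λ y → P x y ×
               (∀ n m → B (iter next n (1 , 0)) (iter next m y) ⇔ typeRel c n m) ×
               (∀ n m → B (iter next n y) (iter next m (1 , 0)) ⇔ typeRel c′ n m)

  -- Boolean-valued relations keep this in `Set`, so that `em` can decide whether a problem has a
  -- solution.
  Solution : (Term → Term → Set) → Problem → Set
  Solution R q = Σ (Term → Term → Bool) λ order → Σ (Term → Term → Bool) λ match →
    Solves R q (λ x y → T (order x y)) (λ x y → T (match x y))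

  record Solved (N : ℕ) (R : Term → Term → Set) (q : Problem) : Set where
    field
      good  : Good R next origin (suc N , 0)
      self  : ∀ n m → R (iter next n (suc N , 0)) (iter next m (suc N , 0)) ⇔ typeRel (proj₂ q) n m
      pairs : ∀ {x c c′} → (x , c , c′) ∈ proj₁ q → proj₁ x ℕ.≤ N →
              (∀ n m → R (iter next n (suc N , 0)) (iter next m x) ⇔ typeRel c n m) ×
              (∀ n m → R (iter next n x) (iter next m (suc N , 0)) ⇔ typeRel c′ n m)

  -- All stages live on the same terms. At stage `N` only the generators up to `N` are significant,
  -- and `rel-+` shows that their order is final.
  record Stage : Set₁ where
    field
      R     : Term → Term → Set
      isPre : IsPre s t R next origin

  module Adjoin (N : ℕ) (S : Stage) (q : Problem) (sol : Solution (Stage.R S) q) where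
    open Stage S
    private
      module B = Solves (proj₂ (proj₂ sol))
      _≼ᴮ_ P : Term → Term → Set
      x ≼ᴮ y = T (proj₁ sol x y)
      P x y = T (proj₁ (proj₂ sol) x y)
    open Amalgam em isPre B.isPre P B.P-o B.P-next B.P-iso using (W; gW; _≤W_; left; right; glue≤; glue≥)
      renaming (isPre to isPreW)

    -- Generator `suc N` loses its provisional meaning and becomes the solving element of `B`; all
    -- others stay in the old stage.
    gens : ℕ → W
    gens i with i ℕ.≟ suc N
    ... | yes _ = inj₂ (1 , 0)
    ... | no _  = inj₁ (i , 0)

    gens-old : ∀ {i} → i ℕ.≤ N → gens i ≡ inj₁ (i , 0)
    gens-old {i} i≤N with i ℕ.≟ suc N
    ... | yes refl = ⊥-elim (ℕ.1+n≰n i≤N)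
    ... | no _     = refl

    gens-new : gens (suc N) ≡ inj₂ (1 , 0)
    gens-new with suc N ℕ.≟ suc N
    ... | yes _ = refl
    ... | no ne = ⊥-elim (ne refl)

    ev : Term → W
    ev = eval gW gens

    R′ : Term → Term → Set
    R′ x y = ev x ≤W ev y

    stage : Stage
    stage = record { R = R′ ; isPre = pullback isPreW ev (λ _ → refl) (gens-old ℕ.z≤n) (λ x y → mk⇔ (λ h → h) (λ h → h)) }

    ev-old : ∀ {x} → proj₁ x ℕ.≤ N → ev x ≡ inj₁ x
    ev-old {i , n} i≤N = trans (cong (iter gW n) (gens-old i≤N))
      (trans (iter-inj₁ next next n (i , 0)) (cong inj₁ (iter-next i n)))

    ev-new : ∀ n → ev (iter next n (suc N , 0)) ≡ inj₂ (iter next n (1 , 0))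
    ev-new n = trans (eval-iter gW gens n (suc N , 0))
      (trans (cong (iter gW n) gens-new) (iter-inj₂ next next n (1 , 0)))

    old : ∀ {x y} → proj₁ x ℕ.≤ N → proj₁ y ℕ.≤ N → R′ x y ⇔ R x y
    old {x} {y} x≤N y≤N = subst₂ (λ u v → (u ≤W v) ⇔ R x y) (sym (ev-old x≤N)) (sym (ev-old y≤N)) (⇔-sym (left x y))

    new-new : ∀ n m → R′ (iter next n (suc N , 0)) (iter next m (suc N , 0)) ⇔ (iter next n (1 , 0) ≼ᴮ iter next m (1 , 0))
    new-new n m = subst₂ (λ u v → (u ≤W v) ⇔ (iter next n (1 , 0) ≼ᴮ iter next m (1 , 0)))
      (sym (ev-new n)) (sym (ev-new m)) (⇔-sym (right _ _))

    -- A matched pair is equivalent in the amalgam together with all its iterates, so the types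
    -- required over `x` can be read off in `B` over `y`.
    glued : ∀ {x y} → P x y → proj₁ x ℕ.≤ N → ∀ n →
      (ev (iter next n x) ≤W inj₂ (iter next n y)) × (inj₂ (iter next n y) ≤W ev (iter next n x))
    glued {x} {y} h x≤N n =
      subst (λ u → (u ≤W inj₂ (iter next n y)) × (inj₂ (iter next n y) ≤W u))
        (sym (ev-old (subst (ℕ._≤ N) (sym (iter-next-gen n x)) x≤N)))
        (glue≤ (P-iter n) , glue≥ (P-iter n))
      where
      P-iter : ∀ n → P (iter next n x) (iter next n y)
      P-iter zero    = h
      P-iter (suc n) = B.P-next (P-iter n)

    reflW : ∀ n → (ev (iter next n (suc N , 0)) ≤W inj₂ (iter next n (1 , 0))) ×
                  (inj₂ (iter next n (1 , 0)) ≤W ev (iter next n (suc N , 0)))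
    reflW n = subst (λ u → (u ≤W inj₂ (iter next n (1 , 0))) × (inj₂ (iter next n (1 , 0)) ≤W u)) (sym (ev-new n))
      (IsPre.reflexive isPreW _ , IsPre.reflexive isPreW _)

    new-old : ∀ {x y} → P x y → proj₁ x ℕ.≤ N → ∀ n m →
      R′ (iter next n (suc N , 0)) (iter next m x) ⇔ (iter next n (1 , 0) ≼ᴮ iter next m y)
    new-old h x≤N n m = ⇔-sym (right _ _) ⇔-∘ ≈-cong isPreW (reflW n) (glued h x≤N m)

    old-new : ∀ {x y} → P x y → proj₁ x ℕ.≤ N → ∀ n m →
      R′ (iter next n x) (iter next m (suc N , 0)) ⇔ (iter next n y ≼ᴮ iter next m (1 , 0))
    old-new h x≤N n m = ⇔-sym (right _ _) ⇔-∘ ≈-cong isPreW (glued h x≤N n) (reflW m)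

    solved : Solved N R′ q
    solved = record
      { good  = good-cong (λ i j → ⇔-sym (new-new i j)) (λ n → ⇔-sym (old-new B.P-o ℕ.z≤n 0 n)) B.good
      ; self  = λ n m → B.self n m ⇔-∘ new-new n m
      ; pairs = λ i x≤N → let (y , h , e , e′) = B.pairs i in
          (λ n m → e n m ⇔-∘ new-old h x≤N n m) , (λ n m → e′ n m ⇔-∘ old-new h x≤N n m)
      }

  -- The second component of `N` is free, so each problem is posed at arbitrarily late stages, in
  -- particular after all the generators that it mentions.
  problem : ℕ → Problem
  problem N = decode codingProblem (proj₁ (unpair N))

  stages : ℕ → Stage
  extended : ∀ N → Dec (Solution (Stage.R (stages N)) (problem N)) → Stage

  extended N (yes sol) = Adjoin.stage N (stages N) (problem N) sol
  extended N (no _)    = stages N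

  stages zero    = record
    { R = λ _ _ → ⊤
    ; isPre = record { transitive = λ _ _ → tt ; total = λ _ _ → inj₁ tt ; mono = λ _ → trivial s ; cancel = λ _ _ → tt
                     ; fix≤ = tt ; fix≥ = tt ; top = λ _ _ → tt } }
    where
    trivial : ∀ s {x y : Term} → Dir s (λ _ _ → ⊤) x y
    trivial true  = tt
    trivial false = tt
  stages (suc N) = extended N em

  rel : ℕ → Term → Term → Set
  rel N = Stage.R (stages N)

  rel-suc : ∀ N {x y} → proj₁ x ℕ.≤ N → proj₁ y ℕ.≤ N → rel (suc N) x y ⇔ rel N x y
  rel-suc N {x} {y} x≤N y≤N = go em
    where
    go : ∀ d → Stage.R (extended N d) x y ⇔ rel N x y
    go (yes sol) = Adjoin.old N (stages N) (problem N) sol x≤N y≤N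
    go (no _)    = mk⇔ (λ h → h) (λ h → h)

  rel-+ : ∀ d N {x y} → proj₁ x ℕ.≤ N → proj₁ y ℕ.≤ N → rel (d + N) x y ⇔ rel N x y
  rel-+ zero    N x≤N y≤N = mk⇔ (λ h → h) (λ h → h)
  rel-+ (suc d) N x≤N y≤N = rel-+ d N x≤N y≤N ⇔-∘
    rel-suc (d + N) (ℕ.≤-trans x≤N (ℕ.m≤n+m N d)) (ℕ.≤-trans y≤N (ℕ.m≤n+m N d))

  rel-solved : ∀ N → Solution (rel N) (problem N) → Solved N (rel (suc N)) (problem N)
  rel-solved N sol = go em
    where
    go : ∀ d → Solved N (Stage.R (extended N d)) (problem N)
    go (yes sol′) = Adjoin.solved N (stages N) (problem N) sol′
    go (no ¬sol)  = ⊥-elim (¬sol sol)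

  -- The sum of the generator indices is one stage at which both generators are final; by `≼⇔rel`
  -- any other such stage gives the same relation.
  record _≼_ (x y : Term) : Set where
    constructor in-limit
    field
      in-stage : rel (proj₁ x + proj₁ y) x y

  ≼⇔rel : ∀ N {x y} → proj₁ x ℕ.≤ N → proj₁ y ℕ.≤ N → (x ≼ y) ⇔ rel N x y
  ≼⇔rel N {x} {y} x≤N y≤N =
    subst (λ K → rel K x y ⇔ rel N x y) (ℕ.+-comm (proj₁ y) (proj₁ x)) (e₂ ⇔-∘ e₁) ⇔-∘ mk⇔ _≼_.in-stage in-limit
    where
    K = proj₁ y + proj₁ x
    e₁ : rel K x y ⇔ rel (N + K) x y
    e₁ = ⇔-sym (rel-+ N K (ℕ.m≤n+m _ _) (ℕ.m≤m+n _ _))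
    e₂ : rel (N + K) x y ⇔ rel N x y
    e₂ = subst (λ L → rel L x y ⇔ rel N x y) (ℕ.+-comm K N) (rel-+ K N x≤N y≤N)

  ≼-isPre : IsPre s t _≼_ next origin
  ≼-isPre = record
    { transitive = λ {x} {y} {z} → tr x y z
    ; total  = tot
    ; mono   = λ {x} {y} q → from (dir s x y) (IsPre.mono (pre (K x y)) (to (e x y) q))
    ; cancel = λ w {x} {y} q → from (e x y) (IsPre.cancel (pre (K x y)) w (to (dir s x y) q))
    ; fix≤   = in-limit (IsPre.fix≤ (pre 0))
    ; fix≥   = in-limit (IsPre.fix≥ (pre 0))
    ; top    = λ w x → in-limit (IsPre.top (pre (proj₁ x + 0)) w x)
    }
    where
    pre : ∀ N → IsPre s t (rel N) next origin
    pre N = Stage.isPre (stages N)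
    K : Term → Term → ℕ
    K x y = proj₁ x + proj₁ y
    e : ∀ x y → (x ≼ y) ⇔ rel (K x y) x y
    e x y = ≼⇔rel (K x y) (ℕ.m≤m+n _ _) (ℕ.m≤n+m _ _)
    dir : ∀ d x y → Dir d _≼_ (next x) (next y) ⇔ Dir d (rel (K x y)) (next x) (next y)
    dir true  x y = ≼⇔rel (K x y) (ℕ.m≤m+n _ _) (ℕ.m≤n+m _ _)
    dir false x y = ≼⇔rel (K x y) (ℕ.m≤n+m _ _) (ℕ.m≤m+n _ _)
    tot : ∀ x y → (x ≼ y) ⊎ (y ≼ x)
    tot x y = Sum.map (from (e x y)) (from (≼⇔rel (K x y) (ℕ.m≤n+m _ _) (ℕ.m≤m+n _ _)))
                (IsPre.total (pre (K x y)) x y)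
    tr : ∀ x y z → x ≼ y → y ≼ z → x ≼ z
    tr x y z q q′ = from (≼⇔rel L x≤L z≤L)
      (IsPre.transitive (pre L) (to (≼⇔rel L x≤L y≤L) q) (to (≼⇔rel L y≤L z≤L) q′))
      where
      L = K x y + proj₁ z
      x≤L = ℕ.≤-trans (ℕ.m≤m+n (proj₁ x) (proj₁ y)) (ℕ.m≤m+n (K x y) (proj₁ z))
      y≤L = ℕ.≤-trans (ℕ.m≤n+m (proj₁ y) (proj₁ x)) (ℕ.m≤m+n (K x y) (proj₁ z))
      z≤L = ℕ.m≤n+m (proj₁ z) (K x y)

  ≼-solved : ∀ N → Solution (rel N) (problem N) → Solved N _≼_ (problem N)
  ≼-solved N sol = record
    { good  = good-cong (λ i j → ⇔-sym (e (iter next i (suc N , 0)) (iter next j (suc N , 0)) (newest i) (newest j)))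
                        (λ n → ⇔-sym (e origin (iter next n (suc N , 0)) ℕ.z≤n (newest n))) good
    ; self  = λ n m → self n m ⇔-∘ e _ _ (newest n) (newest m)
    ; pairs = λ i x≤N → let (c , c′) = pairs i x≤N in
        (λ n m → c n m ⇔-∘ e _ _ (newest n) (older m x≤N)) , (λ n m → c′ n m ⇔-∘ e _ _ (older n x≤N) (newest m))
    }
    where
    open Solved (rel-solved N sol)
    e : ∀ x y → proj₁ x ℕ.≤ suc N → proj₁ y ℕ.≤ suc N → (x ≼ y) ⇔ rel (suc N) x y
    e x y = ≼⇔rel (suc N)
    newest : ∀ n → proj₁ (iter next n (suc N , 0)) ℕ.≤ suc N
    newest n = ℕ.≤-reflexive (iter-next-gen n (suc N , 0))
    older : ∀ n {x} → proj₁ x ℕ.≤ N → proj₁ (iter next n x) ℕ.≤ suc N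
    older n {x} x≤N = ℕ.m≤n⇒m≤1+n (subst (ℕ._≤ N) (sym (iter-next-gen n x)) x≤N)

-- The limit structure and its extension property

module Generic (em : ExcludedMiddle 0ℓ) (k : Kind) (H : Conditions) where
  open TypeCodes em
  open Construction em k H

  private
    s = preserving k
    module L = IsPre ≼-isPre

  -- The point is discarded, and so are the generators of stages whose problem had no solution. The
  -- remaining ones satisfy `H` along their orbits.
  Live : ℕ → Set
  Live zero    = ⊥
  Live (suc N) = Solution (rel N) (problem N)

  LiveTerm : Set
  LiveTerm = Σ Term λ x → Live (proj₁ x)

  live-good : ∀ i → Live i → Good _≼_ next origin (i , 0)
  live-good (suc N) sol = Solved.good (≼-solved N sol)

  _≈_ : LiveTerm → LiveTerm → Set
  x ≈ y = (proj₁ x ≼ proj₁ y) × (proj₁ y ≼ proj₁ x)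

  ≈-trans : ∀ {x y z} → x ≈ y → y ≈ z → x ≈ z
  ≈-trans (a , b) (c , d) = L.transitive a c , L.transitive d b

  encodeTerm : LiveTerm → ℕ
  encodeTerm x = encode (codingℕ ×-coding codingℕ) (proj₁ x)

  encodeTerm-injective : ∀ {x y} → encodeTerm x ≡ encodeTerm y → x ≈ y
  encodeTerm-injective {x} {y} e = subst (λ u → (proj₁ x ≼ u) × (u ≼ proj₁ x)) same (L.reflexive _ , L.reflexive _)
    where
    same : proj₁ x ≡ proj₁ y
    same = trans (sym (decode-encode cT (proj₁ x))) (trans (cong (decode cT) e) (decode-encode cT (proj₁ y)))
      where cT = codingℕ ×-coding codingℕ

  open Quotient em encodeTerm _≈_ (λ {x} {y} → encodeTerm-injective {x} {y}) (λ (a , b) → b , a)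
    (λ {x} {y} {z} → ≈-trans {x} {y} {z})

  term : Quot → Term
  term a = proj₁ (rep a)

  M : Structure
  M = record
    { Carrier = Quot
    ; _≤_ = λ a b → term a ≼ term b
    ; isLinearOrder = record
      { isPartialOrder = record
        { isPreorder = record
          { isEquivalence = isEquivalence
          ; reflexive = λ { refl → L.reflexive _ }
          ; trans = L.transitive }
        ; antisym = λ a≤b b≤a → ≈⇒≡ (a≤b , b≤a) }
      ; total = λ a b → L.total (term a) (term b) }
    ; f = λ a → [ next (term a) , proj₂ (rep a) ]
    }

  Represents : Quot → Term → Set
  Represents a x = (term a ≼ x) × (x ≼ term a)

  represents-term : ∀ a → Represents a (term a)
  represents-term a = L.reflexive _ , L.reflexive _

  represents-[] : ∀ x → Represents [ x ] (proj₁ x)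
  represents-[] x = rep-[] x

  represents-iter : ∀ {a x} n → Represents a x → Represents (fⁿ M n a) (iter next n x)
  represents-iter zero    e = e
  represents-iter {a} {x} (suc n) e =
    let (q , q′) = represents-[] (next (term (fⁿ M n a)) , proj₂ (rep (fⁿ M n a)))
        (h , h′) = g-≈ ≼-isPre (represents-iter n e)
    in L.transitive q h , L.transitive h′ q′

  ≤⇔≼ : ∀ {a b x y} → Represents a x → Represents b y → ∀ n m →
    _≤_ M (fⁿ M n a) (fⁿ M m b) ⇔ (iter next n x ≼ iter next m y)
  ≤⇔≼ e e′ n m = ≈-cong ≼-isPre (represents-iter n e) (represents-iter m e′)

  laws : Laws k M
  laws = record
    { mono   = λ {a} {b} q → from (dir s a b) (L.mono q)
    ; cancel = λ w {a} {b} q → L.cancel w (to (dir s a b) q)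
    }
    where
    dir : ∀ d a b → Dir d (_≤_ M) (f M a) (f M b) ⇔ Dir d _≼_ (next (term a)) (next (term b))
    dir true  a b = ≤⇔≼ {a} {b} (represents-term a) (represents-term b) 1 1
    dir false a b = ≤⇔≼ {b} {a} (represents-term b) (represents-term a) 1 1

  iter-term : ∀ a n → iter next n (term a) ≡ iter next (n + proj₂ (term a)) (proj₁ (term a) , 0)
  iter-term a n = trans (cong (iter next n) (sym (iter-next (proj₁ (term a)) (proj₂ (term a))))) (sym (fold-+ _ next n))

  term-not-top : T s → ∀ a n → ¬ (origin ≼ iter next n (term a))
  term-not-top w a n q = Good.not-top (live-good _ (proj₂ (rep a))) w (n + proj₂ (term a)) (subst (origin ≼_) (iter-term a n) q)

  M∈K : KH k H M
  M∈K = laws⇒base k M laws , λ φ h a → from (sat⇔holds M a φ)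
    (from (holds-cong (λ i j → subst₂ (λ u v → _≤_ M (fⁿ M i a) (fⁿ M j a) ⇔ (u ≼ v)) (iter-term a i) (iter-term a j)
                                 (≤⇔≼ (represents-term a) (represents-term a) i j)) φ)
          (Good.models (live-good _ (proj₂ (rep a))) φ h (proj₂ (term a))))

  countable : Countable Quot
  countable = index , quot-≡

  bound : List Term → ℕ
  bound []       = 0
  bound (x ∷ xs) = proj₁ x + bound xs

  ≤-bound : ∀ {xs x} → x ∈ xs → proj₁ x ℕ.≤ bound xs
  ≤-bound {x ∷ xs} (here refl) = ℕ.m≤m+n _ _
  ≤-bound {x ∷ xs} (there i)   = ℕ.≤-trans (≤-bound i) (ℕ.m≤n+m _ (proj₁ x))

  -- The types of `b` over the matched elements are coded as a problem. The pointed `A` solves it at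
  -- a suitable stage, and the generator adjoined there is the required element.
  module Extend (A : Structure) (A∈K : KH k H A) (ps : List (Quot × Carrier A)) (matched : Matched M A ps)
    (b : Carrier A) where
    open Pointed A renaming (isPre to pointed-isPre; g to fᴬ)

    private
      _⊑_ = PointedOrder s
      lawsA = base⇒laws em k A (proj₁ A∈K)

    preA : IsPre s (strict k) _⊑_ fᴬ nothing
    preA = pointed-isPre s (strict k) (Laws.mono lawsA) (Laws.cancel lawsA)

    ⊑⇔≤ : ∀ a a′ n m → (iter fᴬ n (just a) ⊑ iter fᴬ m (just a′)) ⇔ _≤_ A (fⁿ A n a) (fⁿ A m a′)
    ⊑⇔≤ a a′ n m rewrite iter-just n a | iter-just m a′ = mk⇔ (λ { (inside q) → q }) inside

    just-not-top : T s → ∀ a n → ¬ (nothing ⊑ iter fᴬ n (just a))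
    just-not-top w a n rewrite iter-just n a = go s w
      where
      go : ∀ s → T s → ¬ PointedOrder s nothing (just (fⁿ A n a))
      go true _ ()

    codes : Carrier A → Carrier A → Code
    codes a a′ = proj₁ (type-code preA (just a) (just a′))

    codes-spec : ∀ a a′ n m → (iter fᴬ n (just a) ⊑ iter fᴬ m (just a′)) ⇔ typeRel (codes a a′) n m
    codes-spec a a′ = proj₂ (type-code preA (just a) (just a′))

    question : Quot × Carrier A → Term × Code × Code
    question (x , y) = term x , codes b y , codes y b

    theProblem : Problem
    theProblem = List.map question ps , codes b b

    -- The first component makes stage `N` pose this problem; the second makes `N` bound the
    -- generators of all terms matched in `ps`.
    N : ℕ
    N = pair (encode codingProblem theProblem) (bound (List.map (λ e → term (proj₁ e)) ps))

    problem-N : problem N ≡ theProblem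
    problem-N = trans
      (cong (λ q → decode codingProblem (proj₁ q)) (unpair-pair (encode codingProblem theProblem) _))
      (decode-encode codingProblem theProblem)

    term≤N : ∀ {x y} → (x , y) ∈ ps → proj₁ (term x) ℕ.≤ N
    term≤N i = ℕ.≤-trans (≤-bound (∈-map⁺ _ i)) (pair-≥ʳ _ _)

    entries : List (Term × Maybe (Carrier A))
    entries = (origin , nothing) ∷ List.map (λ (x , y) → term x , just y) ps

    entry≤N : ∀ {x y} → (x , y) ∈ entries → ∀ n → proj₁ (iter next n x) ℕ.≤ N
    entry≤N {x} i n = subst (ℕ._≤ N) (sym (iter-next-gen n x)) (go i)
      where
      go : ∀ {x y} → (x , y) ∈ entries → proj₁ x ℕ.≤ N
      go (here refl) = ℕ.z≤n
      go (there i) with ∈-map⁻ _ i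
      ... | _ , j , refl = term≤N j

    matched-same : ∀ {x y x′ y′} → (x , y) ∈ ps → (x′ , y′) ∈ ps →
      ∀ n m → (iter next n (term x) ≼ iter next m (term x′)) ⇔ (iter fᴬ n (just y) ⊑ iter fᴬ m (just y′))
    matched-same {x} {y} {x′} {y′} i j n m = ⇔-sym (⊑⇔≤ y y′ n m) ⇔-∘
      (matched i j n m ⇔-∘ ⇔-sym (≤⇔≼ (represents-term x) (represents-term x′) n m))

    -- Extends the matching to the points: iterates of a point are replaced by the point, and the
    -- mixed cases are `point-same`.
    entries-same : ∀ {x y x′ y′} → (x , y) ∈ entries → (x′ , y′) ∈ entries →
      ∀ n m → (iter next n x ≼ iter next m x′) ⇔ (iter fᴬ n y ⊑ iter fᴬ m y′)
    entries-same (here refl) (here refl) n m = mk⇔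
      (λ _ → from (≈-cong preA (iter-fix preA n) (iter-fix preA m)) (IsPre.reflexive preA nothing))
      (λ _ → from (≈-cong ≼-isPre (iter-fix ≼-isPre n) (iter-fix ≼-isPre m)) (L.reflexive origin))
    entries-same (there i) (there j) n m with ∈-map⁻ _ i | ∈-map⁻ _ j
    ... | _ , i′ , refl | _ , j′ , refl = matched-same i′ j′ n m
    entries-same (here refl) (there j) n m with ∈-map⁻ _ j
    ... | (x , y) , j′ , refl =
      ⇔-sym (≈-cong preA (iter-fix preA n) (IsPre.reflexive preA _ , IsPre.reflexive preA _)) ⇔-∘
      (proj₂ (point-same s ≼-isPre preA (matched-same j′ j′) (λ w → term-not-top w x) (λ w → just-not-top w y) m)
       ⇔-∘ ≈-cong ≼-isPre (iter-fix ≼-isPre n) (L.reflexive _ , L.reflexive _))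
    entries-same (there i) (here refl) n m with ∈-map⁻ _ i
    ... | (x , y) , i′ , refl =
      ⇔-sym (≈-cong preA (IsPre.reflexive preA _ , IsPre.reflexive preA _) (iter-fix preA m)) ⇔-∘
      (proj₁ (point-same s ≼-isPre preA (matched-same i′ i′) (λ w → term-not-top w x) (λ w → just-not-top w y) n)
       ⇔-∘ ≈-cong ≼-isPre (L.reflexive _ , L.reflexive _) (iter-fix ≼-isPre m))

    nth : List (Quot × Carrier A) → ℕ → Maybe (Carrier A)
    nth []             _       = nothing
    nth ((_ , y) ∷ qs) zero    = just y
    nth (_ ∷ qs)       (suc i) = nth qs i

    ∈-nth : ∀ {qs x y} → (x , y) ∈ qs → Σ ℕ λ i → nth qs i ≡ just y
    ∈-nth (here refl) = 0 , refl
    ∈-nth {_ ∷ _} (there i) = suc (proj₁ (∈-nth i)) , proj₂ (∈-nth i)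

    -- The solution is presented on terms: 0 is the point, 1 is `b`, and the elements of `ps` start
    -- at 2. Generators past the end of `ps` fall back to the point.
    gens : ℕ → Maybe (Carrier A)
    gens zero          = nothing
    gens (suc zero)    = just b
    gens (suc (suc i)) = nth ps i

    ev : Term → Maybe (Carrier A)
    ev = eval fᴬ gens

    -- The closure of the entries under the operation; all terms `u` with the same value in `A` are
    -- linked alike.
    Linked : Term → Term → Set
    Linked x u = Σ (Term × Maybe (Carrier A)) λ e → e ∈ entries × Σ ℕ λ n →
      (x ≡ iter next n (proj₁ e)) × (ev u ≡ iter fᴬ n (proj₂ e))

    -- Stated up to equivalence of relations, so that it applies to the Boolean versions of the
    -- order and of `Linked`.
    solves : (B P : Term → Term → Set) → (∀ u v → B u v ⇔ (ev u ⊑ ev v)) → (∀ x u → P x u ⇔ Linked x u) →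
      Solves (rel N) theProblem B P
    solves B P B⇔ P⇔ = record
      { isPre  = pullback preA ev (λ _ → refl) refl B⇔
      ; good   = record { models = good-models ; not-top = good-low }
      ; P-o    = from (P⇔ _ _) ((origin , nothing) , here refl , 0 , refl , refl)
      ; P-next = λ h → let (e , i , n , q , q′) = to (P⇔ _ _) h
                       in from (P⇔ _ _) (e , i , suc n , cong next q , cong fᴬ q′)
      ; P-iso  = λ {x} {u} {x′} {u′} h h′ → linked-same (to (P⇔ x u) h) (to (P⇔ x′ u′) h′)
      ; self   = λ n m → codes-spec b b n m ⇔-∘ B-iter (1 , 0) (1 , 0) n m
      ; pairs  = answers
      }
      where
      B-iter : ∀ u v n m → B (iter next n u) (iter next m v) ⇔ (iter fᴬ n (ev u) ⊑ iter fᴬ m (ev v))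
      B-iter u v n m = subst₂ (λ c d → B (iter next n u) (iter next m v) ⇔ (c ⊑ d))
        (eval-iter fᴬ gens n u) (eval-iter fᴬ gens m v) (B⇔ _ _)
      linked-same : ∀ {x u x′ u′} → Linked x u → Linked x′ u′ → rel N x x′ ⇔ B u u′
      linked-same {u = u} {u′ = u′} (_ , i , n , refl , q) (_ , i′ , n′ , refl , q′) =
        ⇔-sym (B⇔ u u′) ⇔-∘ (subst₂ (λ c d → _ ⇔ (c ⊑ d)) (sym q) (sym q′) (entries-same i i′ n n′)
                              ⇔-∘ ⇔-sym (≼⇔rel N (entry≤N i n) (entry≤N i′ n′)))
      good-models : ∀ φ → H φ → ∀ n → Holds (λ i j → B (iter next (i + n) (1 , 0)) (iter next (j + n) (1 , 0))) φ
      good-models φ h n = from (holds-cong e φ) (to (sat⇔holds A (fⁿ A n b) φ) (proj₂ A∈K φ h (fⁿ A n b)))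
        where
        e : ∀ i j → B (iter next (i + n) (1 , 0)) (iter next (j + n) (1 , 0)) ⇔ _≤_ A (fⁿ A i (fⁿ A n b)) (fⁿ A j (fⁿ A n b))
        e i j = subst₂ (λ c d → B _ _ ⇔ _≤_ A c d) (fⁿ-+ A i n b) (fⁿ-+ A j n b)
                  (⊑⇔≤ b b (i + n) (j + n) ⇔-∘ B-iter (1 , 0) (1 , 0) (i + n) (j + n))
      good-low : T s → ∀ n → ¬ B origin (iter next n (1 , 0))
      good-low w n q = just-not-top w b n (to (B-iter origin (1 , 0) 0 n) q)
      answers : ∀ {x c c′} → (x , c , c′) ∈ List.map question ps → Σ Term λ y → P x y ×
               (∀ n m → B (iter next n (1 , 0)) (iter next m y) ⇔ typeRel c n m) ×
               (∀ n m → B (iter next n y) (iter next m (1 , 0)) ⇔ typeRel c′ n m)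
      answers i with ∈-map⁻ question i
      ... | (x , y) , j , refl with ∈-nth j
      ...   | l , q = u , from (P⇔ _ _) ((term x , just y) , there (∈-map⁺ _ j) , 0 , refl , q) ,
        (λ n m → codes-spec b y n m ⇔-∘
          subst (λ c → B (iter next n (1 , 0)) (iter next m u) ⇔ (iter fᴬ n (just b) ⊑ iter fᴬ m c)) q (B-iter (1 , 0) u n m)) ,
        (λ n m → codes-spec y b n m ⇔-∘
          subst (λ c → B (iter next n u) (iter next m (1 , 0)) ⇔ (iter fᴬ n c ⊑ iter fᴬ m (just b))) q (B-iter u (1 , 0) n m))
        where
        u : Term
        u = suc (suc l) , 0

    solution : Solution (rel N) theProblem
    solution = (λ u v → isYes (em {ev u ⊑ ev v})) , (λ x u → isYes (em {Linked x u})) ,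
      solves _ _ (λ u v → mk⇔ toWitness fromWitness) (λ x u → mk⇔ toWitness fromWitness)

    live : Live (suc N)
    live = subst (Solution (rel N)) (sym problem-N) solution

    solved : Solved N _≼_ theProblem
    solved = subst (Solved N _≼_) problem-N (≼-solved N live)

    answer : Quot
    answer = [ (suc N , 0) , live ]

    answer-term : Represents answer (suc N , 0)
    answer-term = represents-[] ((suc N , 0) , live)

    extended-match : Matched M A ((answer , b) ∷ ps)
    extended-match (here refl) (here refl) n m =
      ⊑⇔≤ b b n m ⇔-∘ (⇔-sym (codes-spec b b n m) ⇔-∘ (Solved.self solved n m ⇔-∘ ≤⇔≼ answer-term answer-term n m))
    extended-match {x′ = x} {y} (here refl) (there j) n m =
      ⊑⇔≤ b y n m ⇔-∘ (⇔-sym (codes-spec b y n m) ⇔-∘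
        (proj₁ (Solved.pairs solved (∈-map⁺ question j) (term≤N j)) n m ⇔-∘ ≤⇔≼ answer-term (represents-term x) n m))
    extended-match {x} {y} (there i) (here refl) n m =
      ⊑⇔≤ y b n m ⇔-∘ (⇔-sym (codes-spec y b n m) ⇔-∘
        (proj₂ (Solved.pairs solved (∈-map⁺ question i) (term≤N i)) n m ⇔-∘ ≤⇔≼ (represents-term x) answer-term n m))
    extended-match (there i) (there j) n m = matched i j n m

  extension : Extension k H M
  extension A A∈K ps matched b = answer , extended-match
    where open Extend A A∈K ps matched b

theorem5p2 : ExcludedMiddle 0ℓ → (k : Kind) (H : Conditions) →
    Σ Structure (KH k H) →
    Σ Structure λ M → IsFraisseLimit (KHfg k H) M × KH k H M
theorem5p2 em k H _ = M , Limit.isFraïsséLimit em M M∈K countable extension , M∈K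
  where open Generic em k H
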